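{- Let $q>9$ be an odd prime power and let $\widetilde G=\mathrm{PGL}_2(q)$ act on the projective line $\mathrm{GF}(q)\cup\{\infty\}$. Let $\mathcal{Q}$ be the set of nonzero squares in $\mathrm{GF}(q)$, $V_0=\mathcal{Q}\cup\{0\}$ and $U_0=\mathcal{Q}\cup\{\infty\}$. Then: (1) If $q\equiv 1\pmod 4$, the setwise stabiliser of $\mathcal{Q}$ in $\mathrm{PGL}_2(q)$ is $\{x\mapsto ax: a\in\mathcal{Q}\}\cup\{x\mapsto b/x: b\in\mathcal{Q}\}$. (2) The setwise stabilisers of $V_0$ and of $U_0$ in $\mathrm{PGL}_2(q)$ are both equal to $\{x\mapsto ax: a\in\mathcal{Q}\}$.
   Context: $\mathrm{PGL}_2(q)$ is the group of permutations $x\mapsto \frac{ax+b}{cx+d}$ of $\mathrm{GF}(q)\cup\{\infty\}$ with $a,b,c,d\in\mathrm{GF}(q)$, $ad-bc\ne 0$, under composition, with the conventions $a/0=\infty$ for $a\ne 0$ and $\frac{\infty a+b}{\infty c+d}=\frac{a}{c}$. -}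

module Defs where

open import Level using (0ℓ)
open import Algebra.Bundles using (CommutativeRing)
open import Data.Nat using (ℕ; suc)
open import Data.Fin using (Fin)
open import Data.Maybe using (Maybe; just; nothing)
open import Data.Product using (Σ; ∃; _×_; _,_)
open import Data.Sum using (_⊎_)
open import Data.Empty using (⊥)
open import Data.Unit using (⊤)
open import Function.Bundles using (Bijection)
open import Relation.Nullary using (¬_; yes; no)
open import Relation.Binary using (Decidable)
import Relation.Binary.PropositionalEquality as ≡

record FiniteField (q : ℕ) : Set₁ where
  field
    cring  : CommutativeRing 0ℓ 0ℓ
  open CommutativeRing cring public
  field
    _≟_    : Decidable _≈_
    0≉1    : ¬ (0# ≈ 1#)
    _⁻¹    : Carrier → Carrier
    ⁻¹-inv : ∀ x → ¬ (x ≈ 0#) → (x * (x ⁻¹)) ≈ 1#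
    enum   : Bijection setoid (≡.setoid (Fin q))

module _ {q : ℕ} (F : FiniteField q) where
  open FiniteField F

  P1 : Set
  P1 = Maybe Carrier

  ∞ : P1
  ∞ = nothing

  _≈P_ : P1 → P1 → Set
  nothing ≈P nothing = ⊤
  nothing ≈P just _  = ⊥
  just _  ≈P nothing = ⊥
  just x  ≈P just y  = x ≈ y

  record PGLElt : Set where
    constructor mat
    field
      a b c d : Carrier
      det≉0 : ¬ ((a * d) - (b * c) ≈ 0#)

  act : PGLElt → P1 → P1
  act (mat a b c d _) (just x) with ((c * x) + d) ≟ 0#
  ... | yes _ = nothing
  ... | no  _ = just (((a * x) + b) * (((c * x) + d) ⁻¹))
  act (mat a b c d _) nothing with c ≟ 0#
  ... | yes _ = nothing
  ... | no  _ = just (a * (c ⁻¹))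

  IsQ : Carrier → Set
  IsQ x = ¬ (x ≈ 0#) × ∃ λ y → (y * y) ≈ x

  𝒬 : P1 → Set
  𝒬 nothing  = ⊥
  𝒬 (just x) = IsQ x

  V₀ : P1 → Set
  V₀ nothing  = ⊥
  V₀ (just x) = IsQ x ⊎ (x ≈ 0#)

  U₀ : P1 → Set
  U₀ nothing  = ⊤
  U₀ (just x) = IsQ x

  Stabilises : PGLElt → (P1 → Set) → Set
  Stabilises g S =
    (∀ x → S x → S (act g x)) ×
    (∀ y → S y → ∃ λ x → S x × (act g x ≈P y))

  IsScaling : PGLElt → Set
  IsScaling g = ∃ λ e → IsQ e × (∀ x → act g x ≈P (just e ⊙ x))
    where
    _⊙_ : P1 → P1 → P1
    just e ⊙ just x = just (e * x)
    _ ⊙ _ = nothing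

  IsInversion : PGLElt → Set
  IsInversion g = ∃ λ e → IsQ e × (∀ x → act g x ≈P inv e x)
    where
    inv : Carrier → P1 → P1
    inv e nothing = just 0#
    inv e (just x) with x ≟ 0#
    ... | yes _ = nothing
    ... | no  _ = just (e * (x ⁻¹))

{-# OPTIONS --safe #-}
-- Write q = 2m + 1. A nonzero square z satisfies z^m = 1, so if x ↦ (ax+b)/(cx+d) stabilises 𝒬
-- then (ay²+b)^m = (cy²+d)^m for all y ≠ 0. Reduced modulo X^m − 1 and read as a polynomial in y,
-- this has degree less than q − 1, so the coefficients C(m,i) a^i b^(m−i) and C(m,i) c^i d^(m−i)
-- agree for 0 < i < m. If abcd ≠ 0, two consecutive i with C(m,i) ≠ 0 in GF(q) force ad = bc.
-- One can take i = 1, 2, or i = 3, 4 in characteristic 3, where m ≡ 4 (mod 9).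
-- For V₀ the identity gains a factor ay²+b. With A = ad and B = bc, its coefficients at
-- i = 2, 3, 4 yield A = 3B, 14B³ = 0 and 64B⁴ = 0 in turn, which is absurd.
module Submission where

open import Defs
open import Level using (0ℓ)
open import Algebra.Bundles using (CommutativeRing)
open import Algebra.Solver.Ring.AlmostCommutativeRing
  using (fromCommutativeRing; _-Raw-AlmostCommutative⟶_)
import Algebra.Properties.AbelianGroup
import Algebra.Properties.CommutativeMonoid.Sum
import Algebra.Properties.CommutativeSemiring.Exp
import Algebra.Properties.Ring
import Algebra.Properties.Semiring.Exp
import Algebra.Properties.Semiring.Mult
import Algebra.Solver.Ring
open import Data.Empty using (⊥; ⊥-elim)
open import Data.Fin as Fin using (Fin)
open import Data.Fin.Permutation using (Permutation; permutation; _⟨$⟩ʳ_)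
import Data.Fin.Properties as Fin
open import Data.Integer as ℤ using (ℤ; +_; -[1+_])
import Data.Integer.Properties as ℤ
open import Data.Maybe as Maybe using (Maybe; just; nothing)
open import Data.Nat as ℕ using (ℕ; zero; suc; _<_; _%_; _^_; z<s; s<s)
open import Data.Nat.DivMod using (_/_; m≡m%n+[m/n]*n; [m+kn]%n≡m%n; m*n%n≡0; m%n<n)
open import Data.Nat.Divisibility using (_∣_; m%n≡0⇒n∣m; ∣1⇒≡1)
open import Data.Nat.Primality using (Prime; prime?; euclidsLemma; prime⇒irreducible; ¬prime[1])
import Data.Nat.Properties as ℕ
open import Data.Nat.Solver using (module +-*-Solver)
open import Data.Product using (_×_; ∃; _,_; proj₁; proj₂)
import Data.Sign as Sign
open import Data.Sum as ⊎ using (_⊎_; inj₁; inj₂)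
open import Data.Unit using (tt)
open import Function.Base using (_∘_)
open import Function.Bundles using (Bijection; _⇔_; mk⇔)
import Relation.Binary.Reasoning.Setoid
open import Relation.Binary.PropositionalEquality as ≡ using (_≡_)
open import Relation.Nullary using (¬_; contradiction; yes; no)
open import Relation.Nullary.Decidable using (dec⇒maybe; decidable-stable; from-yes)

-- In GF(q) the image M of m satisfies 2M + 1 = 0, so M acts as -1/2 and C(m,i) as C(-1/2,i)
-- wherever i! is invertible: for i = 1, 2, 3, 4 the values are -1/2, 3/8, -5/16, 35/128. Thus
-- C(m,2) vanishes in characteristic 3, and there the formula with i! says nothing from i = 3 on;
-- Pascal's rule replaces it, and m is needed modulo 9. Since q > 9, a power of 3 is then divisible
-- by 9, and 4 < m keeps i = 4 below the top coefficient. For V₀ characteristic 3 excludes itself,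
-- because A = 3B while A ≠ 0. Comparing powers after multiplication by b^i d^i leaves only ad, bc,
-- b^m and d^m as variables, but loses information when b or d is zero; those cases need a separate
-- argument.

-- Integer literals in a commutative ring, and a solver that understands them.

module IntegerCoefficients (R : CommutativeRing 0ℓ 0ℓ) where
  open CommutativeRing R hiding (zero)
  open Algebra.Properties.Ring ring
    using (-‿distribˡ-*; -‿distribʳ-*; -‿involutive; -0#≈0#)
  open Algebra.Properties.AbelianGroup +-abelianGroup
    using (⁻¹-∙-comm; x∙y⁻¹≈ε⇒x≈y; x≈y⇒x∙y⁻¹≈ε)
  open Algebra.Properties.Semiring.Mult semiring using (×-homo-+; ×1-homo-*)
    renaming (_×_ to _·_)
  open Relation.Binary.Reasoning.Setoid setoid

  infix 25 #_
  #_ : ℕ → Carrier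
  # n = n · 1#

  #-homo-+ : ∀ m n → # (m ℕ.+ n) ≈ # m + # n
  #-homo-+ = ×-homo-+ 1#

  #-homo-* : ∀ m n → # (m ℕ.* n) ≈ # m * # n
  #-homo-* = ×1-homo-*

  ⟦_⟧ᶻ : ℤ → Carrier
  ⟦ + n ⟧ᶻ      = # n
  ⟦ -[1+ n ] ⟧ᶻ = - # suc n

  ⟦⟧ᶻ-neg : ∀ i → ⟦ ℤ.- i ⟧ᶻ ≈ - ⟦ i ⟧ᶻ
  ⟦⟧ᶻ-neg (+ zero)   = sym -0#≈0#
  ⟦⟧ᶻ-neg (+ suc n)  = refl
  ⟦⟧ᶻ-neg -[1+ n ]   = sym (-‿involutive _)

  -- Proved by hand, being one of the facts from which the solver is built.
  x+y-[x+z]≈y-z : ∀ x y z → (x + y) - (x + z) ≈ y - z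
  x+y-[x+z]≈y-z x y z = begin
    (x + y) + - (x + z)     ≈⟨ +-cong (+-comm x y) (sym (⁻¹-∙-comm x z)) ⟩
    (y + x) + (- x + - z)   ≈⟨ +-assoc y x _ ⟩
    y + (x + (- x + - z))   ≈⟨ +-congˡ (+-assoc x (- x) (- z)) ⟨
    y + ((x + - x) + - z)   ≈⟨ +-congˡ (+-congʳ (-‿inverseʳ x)) ⟩
    y + (0# + - z)          ≈⟨ +-congˡ (+-identityˡ _) ⟩
    y - z                   ∎

  ⟦⟧ᶻ-⊖ : ∀ m n → ⟦ m ℤ.⊖ n ⟧ᶻ ≈ # m - # n
  ⟦⟧ᶻ-⊖ m zero = begin
    # m         ≈⟨ +-identityʳ _ ⟨
    # m + 0#    ≈⟨ +-congˡ -0#≈0# ⟨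
    # m - 0#    ∎
  ⟦⟧ᶻ-⊖ zero (suc n) = sym (+-identityˡ _)
  ⟦⟧ᶻ-⊖ (suc m) (suc n) = begin
    ⟦ suc m ℤ.⊖ suc n ⟧ᶻ   ≡⟨ ≡.cong ⟦_⟧ᶻ (ℤ.[1+m]⊖[1+n]≡m⊖n m n) ⟩
    ⟦ m ℤ.⊖ n ⟧ᶻ           ≈⟨ ⟦⟧ᶻ-⊖ m n ⟩
    # m - # n              ≈⟨ x+y-[x+z]≈y-z 1# (# m) (# n) ⟨
    # suc m - # suc n      ∎

  ⟦⟧ᶻ-+ : ∀ i j → ⟦ i ℤ.+ j ⟧ᶻ ≈ ⟦ i ⟧ᶻ + ⟦ j ⟧ᶻ
  ⟦⟧ᶻ-+ (+ m)    (+ n)    = #-homo-+ m n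
  ⟦⟧ᶻ-+ (+ m)    -[1+ n ] = ⟦⟧ᶻ-⊖ m (suc n)
  ⟦⟧ᶻ-+ -[1+ m ] (+ n)    = trans (⟦⟧ᶻ-⊖ n (suc m)) (+-comm _ _)
  ⟦⟧ᶻ-+ -[1+ m ] -[1+ n ] = begin
    - # suc (suc (m ℕ.+ n))    ≡⟨ ≡.cong (λ k → - # suc k) (ℕ.+-suc m n) ⟨
    - # (suc m ℕ.+ suc n)      ≈⟨ -‿cong (#-homo-+ (suc m) (suc n)) ⟩
    - (# suc m + # suc n)      ≈⟨ ⁻¹-∙-comm _ _ ⟨
    - # suc m + - # suc n      ∎

  ⟦⟧ᶻ-pos : ∀ n → ⟦ Sign.+ ℤ.◃ n ⟧ᶻ ≈ # n
  ⟦⟧ᶻ-pos n = reflexive (≡.cong ⟦_⟧ᶻ (ℤ.+◃n≡+n n))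

  ⟦⟧ᶻ-negative : ∀ n → ⟦ Sign.- ℤ.◃ n ⟧ᶻ ≈ - # n
  ⟦⟧ᶻ-negative n = trans (reflexive (≡.cong ⟦_⟧ᶻ (ℤ.-◃n≡-n n))) (⟦⟧ᶻ-neg (+ n))

  ⟦⟧ᶻ-* : ∀ i j → ⟦ i ℤ.* j ⟧ᶻ ≈ ⟦ i ⟧ᶻ * ⟦ j ⟧ᶻ
  ⟦⟧ᶻ-* (+ m) (+ n) = trans (⟦⟧ᶻ-pos (m ℕ.* n)) (#-homo-* m n)
  ⟦⟧ᶻ-* (+ m) -[1+ n ] = begin
    ⟦ Sign.- ℤ.◃ (m ℕ.* suc n) ⟧ᶻ   ≈⟨ ⟦⟧ᶻ-negative (m ℕ.* suc n) ⟩
    - # (m ℕ.* suc n)               ≈⟨ -‿cong (#-homo-* m (suc n)) ⟩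
    - (# m * # suc n)               ≈⟨ -‿distribʳ-* _ _ ⟩
    # m * - # suc n                 ∎
  ⟦⟧ᶻ-* -[1+ m ] (+ n) = begin
    ⟦ Sign.- ℤ.◃ (suc m ℕ.* n) ⟧ᶻ   ≈⟨ ⟦⟧ᶻ-negative (suc m ℕ.* n) ⟩
    - # (suc m ℕ.* n)               ≈⟨ -‿cong (#-homo-* (suc m) n) ⟩
    - (# suc m * # n)               ≈⟨ -‿distribˡ-* _ _ ⟩
    - # suc m * # n                 ∎
  ⟦⟧ᶻ-* -[1+ m ] -[1+ n ] = begin
    ⟦ Sign.+ ℤ.◃ (suc m ℕ.* suc n) ⟧ᶻ   ≈⟨ ⟦⟧ᶻ-pos (suc m ℕ.* suc n) ⟩
    # (suc m ℕ.* suc n)                 ≈⟨ #-homo-* (suc m) (suc n) ⟩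
    # suc m * # suc n                   ≈⟨ -‿involutive _ ⟨
    - (- (# suc m * # suc n))           ≈⟨ -‿cong (-‿distribˡ-* _ _) ⟩
    - (- # suc m * # suc n)             ≈⟨ -‿distribʳ-* _ _ ⟩
    - # suc m * - # suc n               ∎

  ℤ⟶R : ℤ.+-*-rawRing -Raw-AlmostCommutative⟶ fromCommutativeRing R
  ℤ⟶R = record
    { ⟦_⟧    = ⟦_⟧ᶻ
    ; +-homo = ⟦⟧ᶻ-+
    ; *-homo = ⟦⟧ᶻ-*
    ; -‿homo = ⟦⟧ᶻ-neg
    ; 0-homo = refl
    -- `# 1` unfolds to `1# + 0#`, which is not definitionally `1#`.
    ; 1-homo = +-identityʳ 1#
    }

  ⟦⟧ᶻ-≟ : ∀ i j → Maybe (⟦ i ⟧ᶻ ≈ ⟦ j ⟧ᶻ)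
  ⟦⟧ᶻ-≟ i j = Maybe.map (reflexive ∘ ≡.cong ⟦_⟧ᶻ) (dec⇒maybe (i ℤ.≟ j))

  module Solver = Algebra.Solver.Ring ℤ.+-*-rawRing (fromCommutativeRing R) ℤ⟶R ⟦⟧ᶻ-≟

  -- These turn a consequence of hypotheses into a ring identity for the solver.
  by-multiple : ∀ {x y u v} k → u ≈ v → x - y ≈ k * (u - v) → x ≈ y
  by-multiple {x} {y} {u} {v} k u≈v eq = x∙y⁻¹≈ε⇒x≈y x y (begin
    x - y         ≈⟨ eq ⟩
    k * (u - v)   ≈⟨ *-congˡ (x≈y⇒x∙y⁻¹≈ε u≈v) ⟩
    k * 0#        ≈⟨ zeroʳ k ⟩
    0#            ∎)

  by-multiples : ∀ {x y u v s t} k l → u ≈ v → s ≈ t →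
                 x - y ≈ k * (u - v) + l * (s - t) → x ≈ y
  by-multiples {x} {y} {u} {v} {s} {t} k l u≈v s≈t eq = x∙y⁻¹≈ε⇒x≈y x y (begin
    x - y                       ≈⟨ eq ⟩
    k * (u - v) + l * (s - t)
      ≈⟨ +-cong (*-congˡ (x≈y⇒x∙y⁻¹≈ε u≈v)) (*-congˡ (x≈y⇒x∙y⁻¹≈ε s≈t)) ⟩
    k * 0# + l * 0#             ≈⟨ +-cong (zeroʳ k) (zeroʳ l) ⟩
    0# + 0#                     ≈⟨ +-identityʳ 0# ⟩
    0#                          ∎)

-- Polynomials as coefficient sequences: roots, powers of linear forms, binomial coefficients.

module Polynomial (R : CommutativeRing 0ℓ 0ℓ) where
  open CommutativeRing R hiding (zero)
  open IntegerCoefficients R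
  open Solver using (solve; _:=_; _:+_; _:*_; _:-_; con)
  open Algebra.Properties.Semiring.Exp semiring
    using () renaming (_^_ to _↑_)
  open Algebra.Properties.AbelianGroup +-abelianGroup using (x∙y⁻¹≈ε⇒x≈y)
  open Relation.Binary.Reasoning.Setoid setoid

  -- A polynomial of degree less than n is given by its first n coefficients.
  eval : ℕ → (ℕ → Carrier) → Carrier → Carrier
  eval zero    f x = 0#
  eval (suc n) f x = f 0 + x * eval n (f ∘ suc) x

  eval-zero : ∀ n {f} x → (∀ i → i < n → f i ≈ 0#) → eval n f x ≈ 0#
  eval-zero zero x f≈0 = refl
  eval-zero (suc n) {f} x f≈0 = begin
    f 0 + x * eval n (f ∘ suc) x
      ≈⟨ +-cong (f≈0 0 z<s) (*-congˡ (eval-zero n x (λ i i<n → f≈0 (suc i) (s<s i<n)))) ⟩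
    0# + x * 0#   ≈⟨ trans (+-identityˡ _) (zeroʳ x) ⟩
    0#            ∎

  eval-linear : ∀ n f g a b x →
                eval n (λ i → a * f i + b * g i) x ≈ a * eval n f x + b * eval n g x
  eval-linear zero f g a b x =
    solve 2 (λ a b → con (+ 0) := a :* con (+ 0) :+ b :* con (+ 0)) refl a b
  eval-linear (suc n) f g a b x = begin
    (a * f 0 + b * g 0) + x * eval n (λ i → a * f (suc i) + b * g (suc i)) x
      ≈⟨ +-congˡ (*-congˡ (eval-linear n (f ∘ suc) (g ∘ suc) a b x)) ⟩
    (a * f 0 + b * g 0) + x * (a * eval n (f ∘ suc) x + b * eval n (g ∘ suc) x)
      ≈⟨ solve 7 (λ a b x f₀ g₀ u v →
           (a :* f₀ :+ b :* g₀) :+ x :* (a :* u :+ b :* v) :=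
           a :* (f₀ :+ x :* u) :+ b :* (g₀ :+ x :* v)) refl
           a b x (f 0) (g 0) (eval n (f ∘ suc) x) (eval n (g ∘ suc) x) ⟩
    a * eval (suc n) f x + b * eval (suc n) g x ∎

  eval-difference : ∀ n f g x → eval n (λ i → f i - g i) x ≈ eval n f x - eval n g x
  eval-difference zero f g x = sym (-‿inverseʳ 0#)
  eval-difference (suc n) f g x = begin
    (f 0 - g 0) + x * eval n (λ i → f (suc i) - g (suc i)) x
      ≈⟨ +-congˡ (*-congˡ (eval-difference n (f ∘ suc) (g ∘ suc) x)) ⟩
    (f 0 - g 0) + x * (eval n (f ∘ suc) x - eval n (g ∘ suc) x)
      ≈⟨ solve 5 (λ x f₀ g₀ u v →
           (f₀ :- g₀) :+ x :* (u :- v) := (f₀ :+ x :* u) :- (g₀ :+ x :* v)) refl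
           x (f 0) (g 0) (eval n (f ∘ suc) x) (eval n (g ∘ suc) x) ⟩
    eval (suc n) f x - eval (suc n) g x ∎

  -- `eval` recurses from the constant term; this opens the other end, where a top coefficient is
  -- reduced or dropped.
  eval-last : ∀ n f x → eval (suc n) f x ≈ eval n f x + f n * x ↑ n
  eval-last zero f x = begin
    f 0 + x * 0#    ≈⟨ trans (+-congˡ (zeroʳ x)) (+-comm _ _) ⟩
    0# + f 0        ≈⟨ +-congˡ (*-identityʳ _) ⟨
    0# + f 0 * 1#   ∎
  eval-last (suc n) f x = begin
    f 0 + x * eval (suc n) (f ∘ suc) x
      ≈⟨ +-congˡ (*-congˡ (eval-last n (f ∘ suc) x)) ⟩
    f 0 + x * (eval n (f ∘ suc) x + f (suc n) * x ↑ n)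
      ≈⟨ solve 5 (λ x f₀ e l p →
           f₀ :+ x :* (e :+ l :* p) := (f₀ :+ x :* e) :+ l :* (x :* p)) refl
           x (f 0) (eval n (f ∘ suc) x) (f (suc n)) (x ↑ n) ⟩
    eval (suc n) f x + f (suc n) * x ↑ suc n ∎

  -- The quotient of f by X - r.
  quotient : ℕ → (ℕ → Carrier) → Carrier → ℕ → Carrier
  quotient n       f r zero    = eval n (f ∘ suc) r
  quotient zero    f r (suc i) = 0#
  quotient (suc n) f r (suc i) = quotient n (f ∘ suc) r i

  -- Synthetic division. With f = f₀ + X g one has f(x) - f(r) = x (g(x) - g(r)) + (x - r) g(r), and
  -- the induction hypothesis divides g(x) - g(r).
  eval-quotient : ∀ n f r x →
    eval (suc n) f x - eval (suc n) f r ≈ (x - r) * eval n (quotient n f r) x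
  eval-quotient zero f r x =
    solve 3 (λ x r f₀ → (f₀ :+ x :* con (+ 0)) :- (f₀ :+ r :* con (+ 0)) :=
                        (x :- r) :* con (+ 0)) refl x r (f 0)
  eval-quotient (suc n) f r x =
    by-multiple x (eval-quotient n (f ∘ suc) r x)
      (solve 6 (λ x r f₀ ex er q →
         ((f₀ :+ x :* ex) :- (f₀ :+ r :* er)) :- (x :- r) :* (er :+ x :* q) :=
         x :* ((ex :- er) :- (x :- r) :* q)) refl
         x r (f 0) (eval (suc n) (f ∘ suc) x) (eval (suc n) (f ∘ suc) r)
         (eval n (quotient n (f ∘ suc) r) x))

  constant≈0 : ∀ n f r → (∀ i → i < n → f (suc i) ≈ 0#) → eval (suc n) f r ≈ 0# → f 0 ≈ 0#
  constant≈0 n f r f≈0 root = begin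
    f 0                            ≈⟨ +-identityʳ _ ⟨
    f 0 + 0#                       ≈⟨ +-congˡ (zeroʳ r) ⟨
    f 0 + r * 0#                   ≈⟨ +-congˡ (*-congˡ (eval-zero n r f≈0)) ⟨
    f 0 + r * eval n (f ∘ suc) r   ≈⟨ root ⟩
    0#                             ∎

  -- Works from the top down: a quotient coefficient is the value at r of a tail of f, and once the
  -- higher coefficients of f vanish this value is a single coefficient.
  quotient≈0 : ∀ n f r → (∀ i → i < n → quotient n f r i ≈ 0#) → ∀ i → i < n → f (suc i) ≈ 0#
  quotient≈0 (suc n) f r q≈0 (suc i) (s<s i<n) =
    quotient≈0 n (f ∘ suc) r (λ j j<n → q≈0 (suc j) (s<s j<n)) i i<n
  quotient≈0 (suc n) f r q≈0 zero _ =
    constant≈0 n (f ∘ suc) r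
      (quotient≈0 n (f ∘ suc) r (λ j j<n → q≈0 (suc j) (s<s j<n)))
      (q≈0 0 z<s)

  -- Induction on the number of roots: the quotient by X - r₀ still vanishes at the remaining
  -- points, since the differences from r₀ are nonzero. `cancel` expresses that the ring has no zero
  -- divisors.
  roots⇒coefficients≈0 :
    (∀ {x y} → x * y ≈ 0# → ¬ x ≈ 0# → y ≈ 0#) →
    ∀ n f (r : Fin n → Carrier) → (∀ {i j} → r i ≈ r j → i ≡ j) →
    (∀ i → eval n f (r i) ≈ 0#) → ∀ i → i < n → f i ≈ 0#
  roots⇒coefficients≈0 cancel (suc n) f r r-inj root = λ where
      zero    _         → constant≈0 n f r₀ tail≈0 (root Fin.zero)
      (suc i) (s<s i<n) → tail≈0 i i<n
    where
    r₀ = r Fin.zero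

    quotient-root : ∀ i → eval n (quotient n f r₀) (r (Fin.suc i)) ≈ 0#
    quotient-root i = cancel
      (begin
        (r (Fin.suc i) - r₀) * eval n (quotient n f r₀) (r (Fin.suc i))
          ≈⟨ eval-quotient n f r₀ (r (Fin.suc i)) ⟨
        eval (suc n) f (r (Fin.suc i)) - eval (suc n) f r₀
          ≈⟨ +-cong (root (Fin.suc i)) (-‿cong (root Fin.zero)) ⟩
        0# - 0#
          ≈⟨ -‿inverseʳ 0# ⟩
        0# ∎)
      (λ eq → contradiction (r-inj (x∙y⁻¹≈ε⇒x≈y _ _ eq)) λ ())

    tail≈0 : ∀ i → i < n → f (suc i) ≈ 0#
    tail≈0 = quotient≈0 n f r₀
      (roots⇒coefficients≈0 cancel n (quotient n f r₀) (r ∘ Fin.suc)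
        (Fin.suc-injective ∘ r-inj) quotient-root)

  -- The coefficients of f(X²).
  spread : (ℕ → Carrier) → ℕ → Carrier
  spread f zero          = f 0
  spread f (suc zero)    = 0#
  spread f (suc (suc i)) = spread (f ∘ suc) i

  spread-even : ∀ f i → spread f (i ℕ.* 2) ≈ f i
  spread-even f zero    = refl
  spread-even f (suc i) = spread-even (f ∘ suc) i

  eval-spread : ∀ n f y → eval (n ℕ.* 2) (spread f) y ≈ eval n f (y * y)
  eval-spread zero    f y = refl
  eval-spread (suc n) f y = begin
    f 0 + y * (0# + y * eval (n ℕ.* 2) (spread (f ∘ suc)) y)
      ≈⟨ +-congˡ (*-congˡ (trans (+-identityˡ _) (*-congˡ (eval-spread n (f ∘ suc) y)))) ⟩
    f 0 + y * (y * eval n (f ∘ suc) (y * y))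
      ≈⟨ +-congˡ (*-assoc y y _) ⟨
    f 0 + (y * y) * eval n (f ∘ suc) (y * y) ∎

  mulLinear : Carrier → Carrier → (ℕ → Carrier) → ℕ → Carrier
  mulLinear a b g zero    = b * g 0
  mulLinear a b g (suc i) = a * g i + b * g (suc i)

  -- The product's coefficient at index n contains `b * g n`, which `eval n g x` on the right does
  -- not see; hence the hypothesis on `g n`.
  eval-mulLinear : ∀ n a b g x → g n ≈ 0# →
                   eval (suc n) (mulLinear a b g) x ≈ (a * x + b) * eval n g x
  eval-mulLinear n a b g x gₙ≈0 = begin
    b * g 0 + x * eval n (λ i → a * g i + b * g (suc i)) x
      ≈⟨ +-congˡ (*-congˡ (eval-linear n g (g ∘ suc) a b x)) ⟩
    b * g 0 + x * (a * eval n g x + b * eval n (g ∘ suc) x)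
      ≈⟨ solve 6 (λ a b x g₀ e t →
           b :* g₀ :+ x :* (a :* e :+ b :* t) := a :* x :* e :+ b :* (g₀ :+ x :* t)) refl
           a b x (g 0) (eval n g x) (eval n (g ∘ suc) x) ⟩
    a * x * eval n g x + b * eval (suc n) g x
      ≈⟨ +-congˡ (*-congˡ (eval-last n g x)) ⟩
    a * x * eval n g x + b * (eval n g x + g n * x ↑ n)
      ≈⟨ +-congˡ (*-congˡ (+-congˡ (trans (*-congʳ gₙ≈0) (zeroˡ _)))) ⟩
    a * x * eval n g x + b * (eval n g x + 0#)
      ≈⟨ +-congˡ (*-congˡ (+-identityʳ _)) ⟩
    a * x * eval n g x + b * eval n g x
      ≈⟨ distribʳ _ _ _ ⟨
    (a * x + b) * eval n g x ∎

  powLinear : Carrier → Carrier → ℕ → ℕ → Carrier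
  powLinear a b zero    zero    = 1#
  powLinear a b zero    (suc i) = 0#
  powLinear a b (suc n)         = mulLinear a b (powLinear a b n)

  powLinear-beyond : ∀ a b {n i} → n < i → powLinear a b n i ≈ 0#
  powLinear-beyond a b {zero}  {suc i} _         = refl
  powLinear-beyond a b {suc n} {suc i} (s<s n<i) = begin
    a * powLinear a b n i + b * powLinear a b n (suc i)
      ≈⟨ +-cong (*-congˡ (powLinear-beyond a b n<i))
                (*-congˡ (powLinear-beyond a b (ℕ.m<n⇒m<1+n n<i))) ⟩
    a * 0# + b * 0#   ≈⟨ +-cong (zeroʳ a) (zeroʳ b) ⟩
    0# + 0#           ≈⟨ +-identityʳ 0# ⟩
    0#                ∎

  eval-powLinear : ∀ a b n x → eval (suc n) (powLinear a b n) x ≈ (a * x + b) ↑ n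
  eval-powLinear a b zero x = trans (+-congˡ (zeroʳ x)) (+-identityʳ 1#)
  eval-powLinear a b (suc n) x = trans
    (eval-mulLinear (suc n) a b (powLinear a b n) x (powLinear-beyond a b (ℕ.n<1+n n)))
    (*-congˡ (eval-powLinear a b n x))

  -- The image of the binomial coefficient in R.
  binom : ℕ → ℕ → Carrier
  binom n       zero    = 1#
  binom zero    (suc i) = 0#
  binom (suc n) (suc i) = binom n i + binom n (suc i)

  powLinear-0 : ∀ a b n → powLinear a b n 0 ≈ b ↑ n
  powLinear-0 a b zero    = refl
  powLinear-0 a b (suc n) = *-congˡ (powLinear-0 a b n)

  -- Unlike `powLinear-binom`, this carries no factor b on the left, so it stays informative when b
  -- is zero.
  powLinear-1 : ∀ a b n → powLinear a b (suc n) 1 ≈ # suc n * (a * b ↑ n)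
  powLinear-1 a b zero = begin
    a * 1# + b * 0#       ≈⟨ trans (+-congˡ (zeroʳ b)) (+-identityʳ _) ⟩
    a * 1#                ≈⟨ *-identityˡ _ ⟨
    1# * (a * 1#)         ≈⟨ *-congʳ (+-identityʳ 1#) ⟨
    # 1 * (a * 1#)        ∎
  powLinear-1 a b (suc n) = begin
    a * powLinear a b (suc n) 0 + b * powLinear a b (suc n) 1
      ≈⟨ +-cong (*-congˡ (powLinear-0 a b (suc n))) (*-congˡ (powLinear-1 a b n)) ⟩
    a * (b * b ↑ n) + b * (# suc n * (a * b ↑ n))
      ≈⟨ +-congʳ (*-identityˡ _) ⟨
    1# * (a * (b * b ↑ n)) + b * (# suc n * (a * b ↑ n))
      ≈⟨ solve 5 (λ o a b p k → o :* (a :* (b :* p)) :+ b :* (k :* (a :* p)) :=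
                                (o :+ k) :* (a :* (b :* p))) refl
           1# a b (b ↑ n) (# suc n) ⟩
    # suc (suc n) * (a * (b * b ↑ n)) ∎

  -- The factor b^i avoids the exponent n - i.
  powLinear-binom : ∀ a b n i → powLinear a b n i * b ↑ i ≈ binom n i * (a ↑ i * b ↑ n)
  powLinear-binom a b n zero = trans (*-congʳ (powLinear-0 a b n))
    (trans (*-comm _ _) (sym (*-identityˡ _)))
  powLinear-binom a b zero (suc i) = trans (zeroˡ _) (sym (zeroˡ _))
  powLinear-binom a b (suc n) (suc i) = begin
    (a * powLinear a b n i + b * powLinear a b n (suc i)) * (b * b ↑ i)
      ≈⟨ solve 5 (λ a b p p′ v → (a :* p :+ b :* p′) :* (b :* v) :=
                                 a :* b :* (p :* v) :+ b :* (p′ :* (b :* v))) refl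
           a b (powLinear a b n i) (powLinear a b n (suc i)) (b ↑ i) ⟩
    a * b * (powLinear a b n i * b ↑ i) + b * (powLinear a b n (suc i) * b ↑ suc i)
      ≈⟨ +-cong (*-congˡ (powLinear-binom a b n i)) (*-congˡ (powLinear-binom a b n (suc i))) ⟩
    a * b * (binom n i * (a ↑ i * b ↑ n)) + b * (binom n (suc i) * (a * a ↑ i * b ↑ n))
      ≈⟨ solve 6 (λ a b k k′ u v →
           a :* b :* (k :* (u :* v)) :+ b :* (k′ :* (a :* u :* v)) :=
           (k :+ k′) :* (a :* u :* (b :* v))) refl
           a b (binom n i) (binom n (suc i)) (a ↑ i) (b ↑ n) ⟩
    binom (suc n) (suc i) * (a ↑ suc i * b ↑ suc n) ∎

  binom-1 : ∀ n → binom n 1 ≈ # n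
  binom-1 zero    = refl
  binom-1 (suc n) = +-congˡ (binom-1 n)

  -- The solver reads the literal 1 as `# 1`, whereas `# suc n` unfolds to a bare `1#` plus `# n`.
  #-suc : ∀ n → # suc n ≈ # 1 + # n
  #-suc n = +-congʳ (sym (+-identityʳ 1#))

  -- The falling factorial formula with i! moved to the left, so that it holds in every
  -- characteristic; likewise for 3 and 4 below.
  binom-2 : ∀ n → # 2 * binom n 2 ≈ # n * (# n - # 1)
  binom-2 zero    = solve 0 (con (+ 2) :* con (+ 0) := con (+ 0) :* (con (+ 0) :- con (+ 1))) refl
  binom-2 (suc n) = begin
    # 2 * (binom n 1 + binom n 2)
      ≈⟨ distribˡ _ _ _ ⟩
    # 2 * binom n 1 + # 2 * binom n 2
      ≈⟨ +-cong (*-congˡ (binom-1 n)) (binom-2 n) ⟩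
    # 2 * # n + # n * (# n - # 1)
      ≈⟨ solve 1 (λ k → con (+ 2) :* k :+ k :* (k :- con (+ 1)) :=
                        (con (+ 1) :+ k) :* ((con (+ 1) :+ k) :- con (+ 1))) refl (# n) ⟩
    (# 1 + # n) * ((# 1 + # n) - # 1)
      ≈⟨ *-cong (#-suc n) (+-congʳ (#-suc n)) ⟨
    # suc n * (# suc n - # 1) ∎

  binom-3 : ∀ n → # 6 * binom n 3 ≈ # n * (# n - # 1) * (# n - # 2)
  binom-3 zero    = solve 0 (con (+ 6) :* con (+ 0) :=
    con (+ 0) :* (con (+ 0) :- con (+ 1)) :* (con (+ 0) :- con (+ 2))) refl
  binom-3 (suc n) = begin
    # 6 * (binom n 2 + binom n 3)
      ≈⟨ solve 2 (λ x y → con (+ 6) :* (x :+ y) := con (+ 3) :* (con (+ 2) :* x) :+ con (+ 6) :* y)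
           refl (binom n 2) (binom n 3) ⟩
    # 3 * (# 2 * binom n 2) + # 6 * binom n 3
      ≈⟨ +-cong (*-congˡ (binom-2 n)) (binom-3 n) ⟩
    # 3 * (# n * (# n - # 1)) + # n * (# n - # 1) * (# n - # 2)
      ≈⟨ solve 1 (λ k →
           con (+ 3) :* (k :* (k :- con (+ 1))) :+ k :* (k :- con (+ 1)) :* (k :- con (+ 2)) :=
           (con (+ 1) :+ k) :* ((con (+ 1) :+ k) :- con (+ 1)) :* ((con (+ 1) :+ k) :- con (+ 2)))
           refl (# n) ⟩
    (# 1 + # n) * ((# 1 + # n) - # 1) * ((# 1 + # n) - # 2)
      ≈⟨ *-cong (*-cong (#-suc n) (+-congʳ (#-suc n))) (+-congʳ (#-suc n)) ⟨
    # suc n * (# suc n - # 1) * (# suc n - # 2) ∎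

  binom-4 : ∀ n → # 24 * binom n 4 ≈ # n * (# n - # 1) * (# n - # 2) * (# n - # 3)
  binom-4 zero    = solve 0 (con (+ 24) :* con (+ 0) :=
    con (+ 0) :* (con (+ 0) :- con (+ 1)) :* (con (+ 0) :- con (+ 2)) :* (con (+ 0) :- con (+ 3))) refl
  binom-4 (suc n) = begin
    # 24 * (binom n 3 + binom n 4)
      ≈⟨ solve 2 (λ x y → con (+ 24) :* (x :+ y) := con (+ 4) :* (con (+ 6) :* x) :+ con (+ 24) :* y)
           refl (binom n 3) (binom n 4) ⟩
    # 4 * (# 6 * binom n 3) + # 24 * binom n 4
      ≈⟨ +-cong (*-congˡ (binom-3 n)) (binom-4 n) ⟩
    # 4 * (# n * (# n - # 1) * (# n - # 2)) + # n * (# n - # 1) * (# n - # 2) * (# n - # 3)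
      ≈⟨ solve 1 (λ k →
           con (+ 4) :* (k :* (k :- con (+ 1)) :* (k :- con (+ 2))) :+
           k :* (k :- con (+ 1)) :* (k :- con (+ 2)) :* (k :- con (+ 3)) :=
           (con (+ 1) :+ k) :* ((con (+ 1) :+ k) :- con (+ 1)) :* ((con (+ 1) :+ k) :- con (+ 2))
             :* ((con (+ 1) :+ k) :- con (+ 3)))
           refl (# n) ⟩
    (# 1 + # n) * ((# 1 + # n) - # 1) * ((# 1 + # n) - # 2) * ((# 1 + # n) - # 3)
      ≈⟨ *-cong (*-cong (*-cong (#-suc n) (+-congʳ (#-suc n))) (+-congʳ (#-suc n)))
                (+-congʳ (#-suc n)) ⟨
    # suc n * (# suc n - # 1) * (# suc n - # 2) * (# suc n - # 3) ∎

  module _ (3≈0 : # 3 ≈ 0#) where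

    -- Coefficientwise form of (1 + X)^3 = 1 + X^3: in Pascal's rule applied three times the two
    -- middle terms carry a factor 3.
    binom-3+ : ∀ n i → binom (3 ℕ.+ n) (3 ℕ.+ i) ≈ binom n (3 ℕ.+ i) + binom n i
    binom-3+ n i = by-multiple (binom n (1 ℕ.+ i) + binom n (2 ℕ.+ i)) 3≈0
      (solve 4 (λ x y z w →
         (((x :+ y) :+ (y :+ z)) :+ ((y :+ z) :+ (z :+ w))) :- (w :+ x) :=
         (y :+ z) :* (con (+ 3) :- con (+ 0))) refl
         (binom n i) (binom n (1 ℕ.+ i)) (binom n (2 ℕ.+ i)) (binom n (3 ℕ.+ i)))

    binom-3+-1 : ∀ n → binom (3 ℕ.+ n) 1 ≈ binom n 1
    binom-3+-1 n = by-multiple 1# 3≈0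
      (solve 2 (λ o x → (o :+ (o :+ (o :+ x))) :- x := o :* (con (+ 3) :- con (+ 0)))
         refl 1# (binom n 1))

    -- Each step of 3 adds the same term, and three such additions cancel. This gives period 9 in n,
    -- not 3, for the lower indices 3 and 4.
    binom-9+-3 : ∀ n → binom (9 ℕ.+ n) 3 ≈ binom n 3
    binom-9+-3 n = begin
      binom (9 ℕ.+ n) 3                     ≈⟨ binom-3+ (6 ℕ.+ n) 0 ⟩
      binom (6 ℕ.+ n) 3 + 1#                ≈⟨ +-congʳ (binom-3+ (3 ℕ.+ n) 0) ⟩
      (binom (3 ℕ.+ n) 3 + 1#) + 1#         ≈⟨ +-congʳ (+-congʳ (binom-3+ n 0)) ⟩
      ((binom n 3 + 1#) + 1#) + 1#
        ≈⟨ by-multiple 1# 3≈0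
             (solve 2 (λ o x → (((x :+ o) :+ o) :+ o) :- x := o :* (con (+ 3) :- con (+ 0)))
               refl 1# (binom n 3)) ⟩
      binom n 3                             ∎

    binom-9+-4 : ∀ n → binom (9 ℕ.+ n) 4 ≈ binom n 4
    binom-9+-4 n = begin
      binom (9 ℕ.+ n) 4
        ≈⟨ binom-3+ (6 ℕ.+ n) 1 ⟩
      binom (6 ℕ.+ n) 4 + binom (6 ℕ.+ n) 1
        ≈⟨ +-cong (binom-3+ (3 ℕ.+ n) 1) (trans (binom-3+-1 (3 ℕ.+ n)) (binom-3+-1 n)) ⟩
      (binom (3 ℕ.+ n) 4 + binom (3 ℕ.+ n) 1) + binom n 1
        ≈⟨ +-congʳ (+-cong (binom-3+ n 1) (binom-3+-1 n)) ⟩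
      ((binom n 4 + binom n 1) + binom n 1) + binom n 1
        ≈⟨ by-multiple (binom n 1) 3≈0
             (solve 2 (λ o x → (((x :+ o) :+ o) :+ o) :- x := o :* (con (+ 3) :- con (+ 0)))
               refl (binom n 1) (binom n 4)) ⟩
      binom n 4 ∎

    -- By periodicity only C(4,3) = 4 matters, which is 1 modulo 3; the next lemma rests on C(4,4) =
    -- 1.
    binom-4+9-3 : ∀ l → binom (4 ℕ.+ l ℕ.* 9) 3 ≈ 1#
    binom-4+9-3 zero    = trans (binom-3+ 1 0) (trans (+-congʳ (+-identityʳ 0#)) (+-identityˡ 1#))
    binom-4+9-3 (suc l) = trans (binom-9+-3 (4 ℕ.+ l ℕ.* 9)) (binom-4+9-3 l)

    binom-4+9-4 : ∀ l → binom (4 ℕ.+ l ℕ.* 9) 4 ≈ 1#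
    binom-4+9-4 zero    = trans (binom-3+ 1 1)
      (trans (+-congʳ (+-identityʳ 0#)) (trans (+-identityˡ _) (+-identityʳ 1#)))
    binom-4+9-4 (suc l) = trans (binom-9+-4 (4 ℕ.+ l ℕ.* 9)) (binom-4+9-4 l)

-- Finite fields: cancellation, division, and sums and products over all elements.

module FieldProperties {q : ℕ} (F : FiniteField q) where
  open FiniteField F hiding (zero)
  open IntegerCoefficients cring
  open Solver using (solve; _:=_; _:+_; _:*_; _:-_)
  open Algebra.Properties.Semiring.Exp semiring using () renaming (_^_ to _↑_)
  open Algebra.Properties.AbelianGroup +-abelianGroup using (x∙y⁻¹≈ε⇒x≈y; ∙-cancelˡ)
  open Relation.Binary.Reasoning.Setoid setoid
  module Sum = Algebra.Properties.CommutativeMonoid.Sum +-commutativeMonoid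
  module Product = Algebra.Properties.CommutativeMonoid.Sum *-commutativeMonoid
    renaming (sum to product)

  1≉0 : ¬ 1# ≈ 0#
  1≉0 = 0≉1 ∘ sym

  ⁻¹-inverseˡ : ∀ {x} → ¬ x ≈ 0# → x ⁻¹ * x ≈ 1#
  ⁻¹-inverseˡ x≉0 = trans (*-comm _ _) (⁻¹-inv _ x≉0)

  *-cancel-≈0 : ∀ {x y} → x * y ≈ 0# → ¬ x ≈ 0# → y ≈ 0#
  *-cancel-≈0 {x} {y} xy≈0 x≉0 = begin
    y                ≈⟨ *-identityˡ y ⟨
    1# * y           ≈⟨ *-congʳ (⁻¹-inverseˡ x≉0) ⟨
    (x ⁻¹ * x) * y   ≈⟨ *-assoc _ _ _ ⟩
    x ⁻¹ * (x * y)   ≈⟨ *-congˡ xy≈0 ⟩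
    x ⁻¹ * 0#        ≈⟨ zeroʳ _ ⟩
    0#               ∎

  *-≉0 : ∀ {x y} → ¬ x ≈ 0# → ¬ y ≈ 0# → ¬ x * y ≈ 0#
  *-≉0 x≉0 y≉0 xy≈0 = y≉0 (*-cancel-≈0 xy≈0 x≉0)

  ↑-≉0 : ∀ {x} n → ¬ x ≈ 0# → ¬ x ↑ n ≈ 0#
  ↑-≉0 zero    x≉0 = 1≉0
  ↑-≉0 (suc n) x≉0 = *-≉0 x≉0 (↑-≉0 n x≉0)

  ↑-≈0⇒≈0 : ∀ {x} n → x ↑ n ≈ 0# → x ≈ 0#
  ↑-≈0⇒≈0 {x} n xⁿ≈0 with x ≟ 0#
  ... | yes x≈0 = x≈0
  ... | no  x≉0 = contradiction xⁿ≈0 (↑-≉0 n x≉0)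

  ↑-cong : ∀ {x y} n → x ≈ y → x ↑ n ≈ y ↑ n
  ↑-cong n x≈y = Algebra.Properties.Semiring.Exp.^-congˡ semiring n x≈y

  *-cancelˡ : ∀ {x y z} → ¬ x ≈ 0# → x * y ≈ x * z → y ≈ z
  *-cancelˡ {x} {y} {z} x≉0 xy≈xz = x∙y⁻¹≈ε⇒x≈y y z (*-cancel-≈0 (begin
    x * (y - z)     ≈⟨ solve 3 (λ x y z → x :* (y :- z) := x :* y :- x :* z) refl x y z ⟩
    x * y - x * z   ≈⟨ +-congʳ xy≈xz ⟩
    x * z - x * z   ≈⟨ -‿inverseʳ _ ⟩
    0#              ∎) x≉0)

  ⁻¹-≉0 : ∀ {x} → ¬ x ≈ 0# → ¬ x ⁻¹ ≈ 0#
  ⁻¹-≉0 {x} x≉0 x⁻¹≈0 = 0≉1 (begin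
    0#         ≈⟨ zeroʳ x ⟨
    x * 0#     ≈⟨ *-congˡ x⁻¹≈0 ⟨
    x * x ⁻¹   ≈⟨ ⁻¹-inv x x≉0 ⟩
    1#         ∎)

  divide : ∀ {u v w} → ¬ v ≈ 0# → u ≈ w * v → u * v ⁻¹ ≈ w
  divide {u} {v} {w} v≉0 u≈wv = begin
    u * v ⁻¹         ≈⟨ *-congʳ u≈wv ⟩
    w * v * v ⁻¹     ≈⟨ *-assoc _ _ _ ⟩
    w * (v * v ⁻¹)   ≈⟨ *-congˡ (⁻¹-inv v v≉0) ⟩
    w * 1#           ≈⟨ *-identityʳ w ⟩
    w                ∎

  undivide : ∀ {u v} → ¬ v ≈ 0# → (u * v ⁻¹) * v ≈ u
  undivide {u} {v} v≉0 = trans (*-assoc _ _ _) (trans (*-congˡ (⁻¹-inverseˡ v≉0)) (*-identityʳ u))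

  index : Carrier → Fin q
  index = Bijection.to enum

  element : Fin q → Carrier
  element = Bijection.to⁻ enum

  index-element : ∀ i → index (element i) ≡ i
  index-element i = proj₂ (Bijection.strictlySurjective enum i)

  element-index : ∀ x → element (index x) ≈ x
  element-index x = Bijection.injective enum (index-element (index x))

  element-injective : ∀ {i j} → element i ≈ element j → i ≡ j
  element-injective {i} {j} eq = ≡.trans (≡.sym (index-element i))
    (≡.trans (Bijection.cong enum eq) (index-element j))

  module _ (f g : Carrier → Carrier)
           (f-cong : ∀ {x y} → x ≈ y → f x ≈ f y) (g-cong : ∀ {x y} → x ≈ y → g x ≈ g y)
           (fg : ∀ x → f (g x) ≈ x) (gf : ∀ x → g (f x) ≈ x) where

    -- Sums and products run over `Fin q`, so a bijection of the field up to `_≈_` is transported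
    -- along `enum` in order to reindex them.
    fieldPermutation : Permutation q q
    fieldPermutation = permutation (index ∘ f ∘ element) (index ∘ g ∘ element)
      (λ i → ≡.trans
        (Bijection.cong enum (trans (f-cong (element-index (g (element i)))) (fg (element i))))
        (index-element i))
      (λ i → ≡.trans
        (Bijection.cong enum (trans (g-cong (element-index (f (element i)))) (gf (element i))))
        (index-element i))

    element-fieldPermutation : ∀ i → element (fieldPermutation ⟨$⟩ʳ i) ≈ f (element i)
    element-fieldPermutation i = element-index (f (element i))

  -- Translation by 1 permutes the field, so the sum S of all elements satisfies S = S + q · 1.
  #order≈0 : # q ≈ 0#
  #order≈0 = sym (∙-cancelˡ (Sum.sum element) 0# (# q) (begin
    Sum.sum element + 0#
      ≈⟨ +-identityʳ _ ⟩
    Sum.sum element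
      ≈⟨ Sum.sum-permute element π ⟩
    Sum.sum (λ i → element (π ⟨$⟩ʳ i))
      ≈⟨ Sum.sum-cong-≋ (element-fieldPermutation _ _ +-congʳ +-congʳ x-1+1 x+1-1) ⟩
    Sum.sum (λ i → element i + 1#)
      ≈⟨ Sum.∑-distrib-+ element (λ _ → 1#) ⟩
    Sum.sum element + Sum.sum {q} (λ _ → 1#)
      ≈⟨ +-congˡ (Sum.sum-replicate q) ⟩
    Sum.sum element + # q ∎))
    where
    x-1+1 : ∀ x → (x - 1#) + 1# ≈ x
    x-1+1 x = solve 2 (λ o x → (x :- o) :+ o := x) refl 1# x

    x+1-1 : ∀ x → (x + 1#) - 1# ≈ x
    x+1-1 x = solve 2 (λ o x → (x :+ o) :- o := x) refl 1# x

    π = fieldPermutation (_+ 1#) (_- 1#) +-congʳ +-congʳ x-1+1 x+1-1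

  -- Putting 1 in place of the factor at 0 lets a product over the nonzero elements run over all of
  -- `Fin q`.
  ifNonzero : Carrier → Carrier → Carrier
  ifNonzero x y with x ≟ 0#
  ... | yes _ = 1#
  ... | no  _ = y

  ifNonzero-yes : ∀ {x y} → x ≈ 0# → ifNonzero x y ≈ 1#
  ifNonzero-yes {x} x≈0 with x ≟ 0#
  ... | yes _   = refl
  ... | no  x≉0 = contradiction x≈0 x≉0

  ifNonzero-no : ∀ {x y} → ¬ x ≈ 0# → ifNonzero x y ≈ y
  ifNonzero-no {x} x≉0 with x ≟ 0#
  ... | yes x≈0 = contradiction x≈0 x≉0
  ... | no  _   = refl

  ifNonzero-≉0 : ∀ x → ¬ ifNonzero x x ≈ 0#
  ifNonzero-≉0 x with x ≟ 0#
  ... | yes _   = 1≉0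
  ... | no  x≉0 = x≉0

  ifNonzero-* : ∀ {x y z} → ¬ y ≈ 0# → z ≈ y * x →
                ifNonzero z z ≈ ifNonzero x y * ifNonzero x x
  ifNonzero-* {x} {y} {z} y≉0 z≈yx with x ≟ 0#
  ... | yes x≈0 = trans (ifNonzero-yes (trans z≈yx (trans (*-congˡ x≈0) (zeroʳ y))))
                        (sym (*-identityˡ 1#))
  ... | no  x≉0 = trans (ifNonzero-no (λ z≈0 → *-≉0 y≉0 x≉0 (trans (sym z≈yx) z≈0))) z≈yx

  product-≉0 : ∀ {n} (f : Fin n → Carrier) → (∀ i → ¬ f i ≈ 0#) → ¬ Product.product f ≈ 0#
  product-≉0 {zero}  f f≉0 = 1≉0
  product-≉0 {suc n} f f≉0 = *-≉0 (f≉0 Fin.zero) (product-≉0 (f ∘ Fin.suc) (f≉0 ∘ Fin.suc))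

-- Polynomials vanishing on the nonzero squares of a field of order 2m + 1.

module OddOrder {m : ℕ} (F : FiniteField (suc (m ℕ.* 2))) where
  open FiniteField F hiding (zero)
  open FieldProperties F
  open IntegerCoefficients cring
  open Polynomial cring
  open Solver using (solve; _:=_; _:+_; _:*_)
  open Algebra.Properties.Semiring.Exp semiring using () renaming (_^_ to _↑_)
  open Algebra.Properties.AbelianGroup +-abelianGroup
    using (x≈y⇒x∙y⁻¹≈ε)
  open Relation.Binary.Reasoning.Setoid setoid

  -- Multiplication by y permutes the nonzero elements, hence fixes their product.
  fermat : ∀ {y} → ¬ y ≈ 0# → y ↑ (m ℕ.* 2) ≈ 1#
  fermat {y} y≉0 = *-cancelˡ (product-≉0 w (λ i → ifNonzero-≉0 (element i))) (begin
    Product.product w * y ↑ (m ℕ.* 2)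
      ≈⟨ *-comm _ _ ⟩
    y ↑ (m ℕ.* 2) * Product.product w
      ≈⟨ *-congʳ product-u ⟨
    Product.product u * Product.product w
      ≈⟨ Product.∑-distrib-+ u w ⟨
    Product.product (λ i → u i * w i)
      ≈⟨ Product.sum-cong-≋ (λ i → ifNonzero-* y≉0
           (element-fieldPermutation _ _ *-congˡ *-congˡ yy⁻¹x y⁻¹yx i)) ⟨
    Product.product (λ i → w (π ⟨$⟩ʳ i))
      ≈⟨ Product.sum-permute w π ⟨
    Product.product w
      ≈⟨ *-identityʳ _ ⟨
    Product.product w * 1# ∎)
    where
    w u : Fin (suc (m ℕ.* 2)) → Carrier
    w i = ifNonzero (element i) (element i)
    -- One factor y for each nonzero element and 1 at zero, so that u times w is w reindexed by
    -- multiplication by y.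
    u i = ifNonzero (element i) y

    yy⁻¹x : ∀ x → y * (y ⁻¹ * x) ≈ x
    yy⁻¹x x = trans (sym (*-assoc _ _ _)) (trans (*-congʳ (⁻¹-inv y y≉0)) (*-identityˡ x))

    y⁻¹yx : ∀ x → y ⁻¹ * (y * x) ≈ x
    y⁻¹yx x = trans (sym (*-assoc _ _ _)) (trans (*-congʳ (⁻¹-inverseˡ y≉0)) (*-identityˡ x))

    π = fieldPermutation (y *_) (y ⁻¹ *_) *-congˡ *-congˡ yy⁻¹x y⁻¹yx

    i₀ = index 0#

    element-punchIn : ∀ j → ¬ element (Fin.punchIn i₀ j) ≈ 0#
    element-punchIn j eq = Fin.punchInᵢ≢i i₀ j
      (element-injective (trans eq (sym (element-index 0#))))

    product-u : Product.product u ≈ y ↑ (m ℕ.* 2)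
    product-u = begin
      Product.product u
        ≈⟨ Product.sum-remove {i = i₀} u ⟩
      u i₀ * Product.product (λ j → u (Fin.punchIn i₀ j))
        ≈⟨ *-cong (ifNonzero-yes (element-index 0#))
                  (Product.sum-cong-≋ (λ j → ifNonzero-no (element-punchIn j))) ⟩
      1# * Product.product {m ℕ.* 2} (λ _ → y)
        ≈⟨ *-identityˡ _ ⟩
      Product.product {m ℕ.* 2} (λ _ → y)
        ≈⟨ Product.sum-replicate (m ℕ.* 2) ⟩
      y ↑ (m ℕ.* 2) ∎

  square-↑ : ∀ n y → (y * y) ↑ n ≈ y ↑ (n ℕ.* 2)
  square-↑ zero    y = refl
  square-↑ (suc n) y = trans (*-congˡ (square-↑ n y)) (*-assoc y y _)

  square-↑m : ∀ {y} → ¬ y ≈ 0# → (y * y) ↑ m ≈ 1#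
  square-↑m {y} y≉0 = trans (square-↑ m y) (fermat y≉0)

  -- y h(y²) has degree less than q and vanishes on all of GF(q).
  vanishing-on-squares : ∀ h → (∀ {y} → ¬ y ≈ 0# → eval m h (y * y) ≈ 0#) →
                         ∀ i → i < m → h i ≈ 0#
  vanishing-on-squares h h≈0 i i<m = trans (sym (spread-even h i))
    (roots⇒coefficients≈0 *-cancel-≈0 (suc (m ℕ.* 2)) xh element element-injective
      (λ j → root (element j)) (suc (i ℕ.* 2)) (s<s (ℕ.*-monoˡ-< 2 i<m)))
    where
    xh : ℕ → Carrier
    xh zero    = 0#
    xh (suc j) = spread h j

    root : ∀ y → 0# + y * eval (m ℕ.* 2) (spread h) y ≈ 0#
    root y with y ≟ 0#
    ... | yes y≈0 = trans (+-identityˡ _) (trans (*-congʳ y≈0) (zeroˡ _))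
    ... | no  y≉0 = trans (+-identityˡ _)
      (trans (*-congˡ (trans (eval-spread m h y) (h≈0 y≉0))) (zeroʳ y))

  -- Degree m is one too many for `vanishing-on-squares`. As z^m = 1 on nonzero squares, the leading
  -- coefficient can be moved onto the constant one; only their sum is then controlled, which is why
  -- both ends are missing from the conclusion.
  inner-coefficients≈0 : ∀ f → (∀ {y} → ¬ y ≈ 0# → eval (suc m) f (y * y) ≈ 0#) →
                         ∀ i → suc i < m → f (suc i) ≈ 0#
  inner-coefficients≈0 f f≈0 i 1+i<m = vanishing-on-squares h (λ {y} → h≈0 {y}) (suc i) 1+i<m
    where
    -- The remainder of f modulo X^m - 1.
    h : ℕ → Carrier
    h zero    = f 0 + f m
    h (suc j) = f (suc j)

    eval-h : ∀ n → 0 < n → ∀ x → eval n h x ≈ eval n f x + f m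
    eval-h (suc n) _ x = solve 4 (λ a b x e → (a :+ b) :+ x :* e := (a :+ x :* e) :+ b) refl
      (f 0) (f m) x (eval n (f ∘ suc) x)

    h≈0 : ∀ {y} → ¬ y ≈ 0# → eval m h (y * y) ≈ 0#
    h≈0 {y} y≉0 = begin
      eval m h (y * y)                        ≈⟨ eval-h m (ℕ.≤-<-trans ℕ.z≤n 1+i<m) (y * y) ⟩
      eval m f (y * y) + f m                  ≈⟨ +-congˡ (*-identityʳ _) ⟨
      eval m f (y * y) + f m * 1#             ≈⟨ +-congˡ (*-congˡ (square-↑m y≉0)) ⟨
      eval m f (y * y) + f m * (y * y) ↑ m    ≈⟨ eval-last m f (y * y) ⟨
      eval (suc m) f (y * y)                  ≈⟨ f≈0 y≉0 ⟩
      0#                                      ∎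

  module _ (a b c d : Carrier) where

    -- The coefficients of (aX + b)^m - (cX + d)^m.
    gap : ℕ → Carrier
    gap i = powLinear a b m i - powLinear c d m i

    eval-gap : ∀ x → eval (suc m) gap x ≈ (a * x + b) ↑ m - (c * x + d) ↑ m
    eval-gap x = trans (eval-difference (suc m) (powLinear a b m) (powLinear c d m) x)
      (+-cong (eval-powLinear a b m x) (-‿cong (eval-powLinear c d m x)))

    gap≈0 : (∀ {y} → ¬ y ≈ 0# → (a * (y * y) + b) ↑ m ≈ (c * (y * y) + d) ↑ m) →
            ∀ i → suc i < m → gap (suc i) ≈ 0#
    gap≈0 hyp = inner-coefficients≈0 gap
      (λ {y} y≉0 → trans (eval-gap (y * y)) (x≈y⇒x∙y⁻¹≈ε (hyp y≉0)))

    -- The hypothesis includes y = 0, so the constant coefficient vanishes and X can be divided out.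
    -- This offsets the degree gained from aX + b, and `inner-coefficients≈0` applies to the
    -- quotient.
    linear-gap : (∀ y → (a * (y * y) + b) * ((a * (y * y) + b) ↑ m - (c * (y * y) + d) ↑ m) ≈ 0#) →
                 b * (b ↑ m - d ↑ m) ≈ 0# ×
                 (∀ i → suc i < m → a * gap (suc i) + b * gap (suc (suc i)) ≈ 0#)
    linear-gap hyp = constant , inner-coefficients≈0 (f ∘ suc) tail≈0
      where
      f : ℕ → Carrier
      f = mulLinear a b gap

      eval-f : ∀ y → eval (suc (suc m)) f (y * y) ≈ 0#
      eval-f y = trans
        (eval-mulLinear (suc m) a b gap (y * y)
          (trans (+-cong (powLinear-beyond a b (ℕ.n<1+n m))
                         (-‿cong (powLinear-beyond c d (ℕ.n<1+n m))))
                 (-‿inverseʳ 0#)))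
        (trans (*-congˡ (eval-gap (y * y))) (hyp y))

      f₀≈0 : f 0 ≈ 0#
      f₀≈0 = begin
        f 0                                  ≈⟨ +-identityʳ _ ⟨
        f 0 + 0#                             ≈⟨ +-congˡ (trans (*-congʳ (zeroˡ 0#)) (zeroˡ _)) ⟨
        eval (suc (suc m)) f (0# * 0#)       ≈⟨ eval-f 0# ⟩
        0#                                   ∎

      constant : b * (b ↑ m - d ↑ m) ≈ 0#
      constant = trans
        (*-congˡ (+-cong (sym (powLinear-0 a b m)) (-‿cong (sym (powLinear-0 c d m))))) f₀≈0

      tail≈0 : ∀ {y} → ¬ y ≈ 0# → eval (suc m) (f ∘ suc) (y * y) ≈ 0#
      tail≈0 {y} y≉0 = *-cancel-≈0
        (begin
          (y * y) * eval (suc m) (f ∘ suc) (y * y)         ≈⟨ +-identityˡ _ ⟨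
          0# + (y * y) * eval (suc m) (f ∘ suc) (y * y)    ≈⟨ +-congʳ f₀≈0 ⟨
          eval (suc (suc m)) f (y * y)                     ≈⟨ eval-f y ⟩
          0#                                               ∎)
        (*-≉0 y≉0 y≉0)

-- Rigidity: the coefficient identities force a diagonal or antidiagonal matrix.

module Rigidity {m : ℕ} (F : FiniteField (suc (m ℕ.* 2))) (4<m : 4 < m) where
  open FiniteField F hiding (zero)
  open FieldProperties F
  open OddOrder {m} F
  open IntegerCoefficients cring
  open Polynomial cring
  open Solver using (solve; _:=_; _:+_; _:*_; _:-_; :-_; _:^_; con)
  open Algebra.Properties.Semiring.Exp semiring using () renaming (_^_ to _↑_)
  open Algebra.Properties.CommutativeSemiring.Exp commutativeSemiring using (^-distrib-*)
  open Algebra.Properties.AbelianGroup +-abelianGroup using (x∙y⁻¹≈ε⇒x≈y; x≈y⇒x∙y⁻¹≈ε)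
  open Relation.Binary.Reasoning.Setoid setoid

  M : Carrier
  M = # m

  -- This is q = 0 in the field. The numerical constants below arise from eliminating M with it.
  2M+1≈0 : # 2 * M + # 1 ≈ 0#
  2M+1≈0 = begin
    # 2 * M + # 1       ≈⟨ +-cong (*-comm _ _) (+-identityʳ 1#) ⟩
    M * # 2 + 1#        ≈⟨ +-comm _ _ ⟩
    1# + M * # 2        ≈⟨ +-congˡ (#-homo-* m 2) ⟨
    # suc (m ℕ.* 2)     ≈⟨ #order≈0 ⟩
    0#                  ∎

  #1≉0 : ¬ # 1 ≈ 0#
  #1≉0 = 1≉0 ∘ trans (sym (+-identityʳ 1#))

  #2≉0 : ¬ # 2 ≈ 0#
  #2≉0 2≈0 = #1≉0 (by-multiples (# 1) (- M) 2M+1≈0 2≈0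
    (solve 1 (λ M → con (+ 1) :- con (+ 0) :=
       con (+ 1) :* ((con (+ 2) :* M :+ con (+ 1)) :- con (+ 0)) :+
       (:- M) :* (con (+ 2) :- con (+ 0))) refl M))

  M≉0 : ¬ M ≈ 0#
  M≉0 M≈0 = #1≉0 (by-multiples (# 1) (- # 2) 2M+1≈0 M≈0
    (solve 1 (λ M → con (+ 1) :- con (+ 0) :=
       con (+ 1) :* ((con (+ 2) :* M :+ con (+ 1)) :- con (+ 0)) :+
       (:- con (+ 2)) :* (M :- con (+ 0))) refl M))

  -- 2M + 1 = 2(M - 1) + 3; division by M - 2 instead leaves 5.
  M-1≉0 : ¬ # 3 ≈ 0# → ¬ M - # 1 ≈ 0#
  M-1≉0 3≉0 M-1≈0 = 3≉0 (by-multiples (# 1) (- # 2) 2M+1≈0 M-1≈0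
    (solve 1 (λ M → con (+ 3) :- con (+ 0) :=
       con (+ 1) :* ((con (+ 2) :* M :+ con (+ 1)) :- con (+ 0)) :+
       (:- con (+ 2)) :* ((M :- con (+ 1)) :- con (+ 0))) refl M))

  M-2≉0 : ¬ # 5 ≈ 0# → ¬ M - # 2 ≈ 0#
  M-2≉0 5≉0 M-2≈0 = 5≉0 (by-multiples (# 1) (- # 2) 2M+1≈0 M-2≈0
    (solve 1 (λ M → con (+ 5) :- con (+ 0) :=
       con (+ 1) :* ((con (+ 2) :* M :+ con (+ 1)) :- con (+ 0)) :+
       (:- con (+ 2)) :* ((M :- con (+ 2)) :- con (+ 0))) refl M))

  0<m : 0 < m
  0<m = ℕ.<-trans z<s 4<m

  binom-m-1≉0 : ¬ binom m 1 ≈ 0#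
  binom-m-1≉0 = M≉0 ∘ trans (sym (binom-1 m))

  binom-m-2≉0 : ¬ # 3 ≈ 0# → ¬ binom m 2 ≈ 0#
  binom-m-2≉0 3≉0 eq = *-≉0 M≉0 (M-1≉0 3≉0)
    (trans (sym (binom-2 m)) (trans (*-congˡ eq) (zeroʳ _)))

  powLinear-m-1 : ∀ a b → powLinear a b m 1 ≈ M * (a * b ↑ ℕ.pred m)
  powLinear-m-1 a b = ≡.subst (λ n → powLinear a b n 1 ≈ # n * (a * b ↑ ℕ.pred m))
    (ℕ.suc-pred m {{ℕ.>-nonZero 0<m}}) (powLinear-1 a b (ℕ.pred m))

  ↑pred-m≈0 : ∀ {x} → x ≈ 0# → x ↑ ℕ.pred m ≈ 0#
  ↑pred-m≈0 {x} x≈0 = go (ℕ.pred m) (ℕ.<-trans z<s (ℕ.pred-mono-< 4<m))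
    where
    go : ∀ n → 0 < n → x ↑ n ≈ 0#
    go (suc n) _ = trans (*-congʳ x≈0) (zeroˡ _)

  -- The factor b^i d^i makes both halves of the gap depend on i through powers of ad and bc only,
  -- with no exponent m - i.
  gap-binom : ∀ a b c d i → gap a b c d i * (b ↑ i * d ↑ i) ≈
                    binom m i * ((a * d) ↑ i * b ↑ m - (b * c) ↑ i * d ↑ m)
  gap-binom a b c d i = begin
    (powLinear a b m i - powLinear c d m i) * (b ↑ i * d ↑ i)
      ≈⟨ solve 4 (λ p r u v → (p :- r) :* (u :* v) := (p :* u) :* v :- (r :* v) :* u) refl
           (powLinear a b m i) (powLinear c d m i) (b ↑ i) (d ↑ i) ⟩
    (powLinear a b m i * b ↑ i) * d ↑ i - (powLinear c d m i * d ↑ i) * b ↑ i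
      ≈⟨ +-cong (*-congʳ (powLinear-binom a b m i)) (-‿cong (*-congʳ (powLinear-binom c d m i))) ⟩
    (binom m i * (a ↑ i * b ↑ m)) * d ↑ i - (binom m i * (c ↑ i * d ↑ m)) * b ↑ i
      ≈⟨ solve 7 (λ k a b c d v w →
           (k :* (a :* v)) :* d :- (k :* (c :* w)) :* b :=
           k :* ((a :* d) :* v :- (b :* c) :* w)) refl
           (binom m i) (a ↑ i) (b ↑ i) (c ↑ i) (d ↑ i) (b ↑ m) (d ↑ m) ⟩
    binom m i * ((a ↑ i * d ↑ i) * b ↑ m - (b ↑ i * c ↑ i) * d ↑ m)
      ≈⟨ *-congˡ (+-cong (*-congʳ (^-distrib-* a d i)) (-‿cong (*-congʳ (^-distrib-* b c i)))) ⟨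
    binom m i * ((a * d) ↑ i * b ↑ m - (b * c) ↑ i * d ↑ m) ∎

  module _ {a b c d : Carrier} (det≉0 : ¬ a * d - b * c ≈ 0#) where

    -- Free of the factors b and d that `gap-binom` introduces, so this coefficient settles the
    -- cases in which an entry of the matrix is zero.
    gap₁ : gap a b c d 1 ≈ 0# → a * b ↑ ℕ.pred m ≈ c * d ↑ ℕ.pred m
    gap₁ eq = *-cancelˡ M≉0
      (trans (sym (powLinear-m-1 a b)) (trans (x∙y⁻¹≈ε⇒x≈y _ _ eq) (powLinear-m-1 c d)))

    ad≈0⇒b≉0 : a * d ≈ 0# → ¬ b ≈ 0#
    ad≈0⇒b≉0 ad≈0 b≈0 = det≉0
      (trans (+-cong ad≈0 (-‿cong (trans (*-congʳ b≈0) (zeroˡ c)))) (-‿inverseʳ 0#))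

    ad≈0⇒c≉0 : a * d ≈ 0# → ¬ c ≈ 0#
    ad≈0⇒c≉0 ad≈0 c≈0 = det≉0
      (trans (+-cong ad≈0 (-‿cong (trans (*-congˡ c≈0) (zeroʳ b)))) (-‿inverseʳ 0#))

    a≈0⇒ad≈0 : a ≈ 0# → a * d ≈ 0#
    a≈0⇒ad≈0 a≈0 = trans (*-congʳ a≈0) (zeroˡ d)

    d≈0⇒ad≈0 : d ≈ 0# → a * d ≈ 0#
    d≈0⇒ad≈0 d≈0 = trans (*-congˡ d≈0) (zeroʳ a)

    b≈0⇒ad≉0 : b ≈ 0# → ¬ a * d ≈ 0#
    b≈0⇒ad≉0 b≈0 ad≈0 = ad≈0⇒b≉0 ad≈0 b≈0

    gap₁-b≈0 : gap a b c d 1 ≈ 0# → b ≈ 0# → c ≈ 0#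
    gap₁-b≈0 eq b≈0 = *-cancel-≈0
      (begin
        d ↑ ℕ.pred m * c     ≈⟨ *-comm _ _ ⟩
        c * d ↑ ℕ.pred m     ≈⟨ gap₁ eq ⟨
        a * b ↑ ℕ.pred m     ≈⟨ *-congˡ (↑pred-m≈0 b≈0) ⟩
        a * 0#               ≈⟨ zeroʳ a ⟩
        0#                   ∎)
      (↑-≉0 (ℕ.pred m) (b≈0⇒ad≉0 b≈0 ∘ d≈0⇒ad≈0))

    gap≈0⇒ : ∀ i → ¬ binom m i ≈ 0# → gap a b c d i ≈ 0# →
             (a * d) ↑ i * b ↑ m ≈ (b * c) ↑ i * d ↑ m
    gap≈0⇒ i k≉0 eq = x∙y⁻¹≈ε⇒x≈y _ _ (*-cancel-≈0
      (trans (sym (gap-binom a b c d i)) (trans (*-congʳ eq) (zeroˡ _))) k≉0)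

    -- With A = ad and B = bc, the relation A^i b^m = B^i d^m at i + 1 divided by the one at i
    -- leaves A = B. Only A^i b^m is cancelled, so B and d^m need no inverse.
    consecutive-gaps : ∀ i → ¬ binom m i ≈ 0# → ¬ binom m (suc i) ≈ 0# →
                       gap a b c d i ≈ 0# → gap a b c d (suc i) ≈ 0# →
                       ¬ a * d ≈ 0# → ¬ b ≈ 0# → ⊥
    consecutive-gaps i k≉0 k′≉0 eq eq′ ad≉0 b≉0 =
      det≉0 (x≈y⇒x∙y⁻¹≈ε (*-cancelˡ (*-≉0 (↑-≉0 i ad≉0) (↑-≉0 m b≉0)) (begin
        ((a * d) ↑ i * b ↑ m) * (a * d)   ≈⟨ trans (*-comm _ _) (sym (*-assoc _ _ _)) ⟩
        (a * d) ↑ suc i * b ↑ m           ≈⟨ gap≈0⇒ (suc i) k′≉0 eq′ ⟩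
        (b * c) ↑ suc i * d ↑ m           ≈⟨ trans (*-assoc _ _ _) (*-comm _ _) ⟩
        ((b * c) ↑ i * d ↑ m) * (b * c)   ≈⟨ *-congʳ (gap≈0⇒ i k≉0 eq) ⟨
        ((a * d) ↑ i * b ↑ m) * (b * c)   ∎)))

    gaps≈0⇒monomial : (# 3 ≈ 0# → ∃ λ l → m ≡ 4 ℕ.+ l ℕ.* 9) →
      (∀ {y} → ¬ y ≈ 0# → (a * (y * y) + b) ↑ m ≈ (c * (y * y) + d) ↑ m) →
      (b ≈ 0# × c ≈ 0#) ⊎ (a ≈ 0# × d ≈ 0#)
    gaps≈0⇒monomial char3 hyp with a ≟ 0# | b ≟ 0# | d ≟ 0#
    ... | yes a≈0 | _ | _ = inj₂ (a≈0 , ↑-≈0⇒≈0 (ℕ.pred m) (*-cancel-≈0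
            (trans (sym (gap₁ (gap≈0 a b c d hyp 0 (ℕ.<-trans (s<s z<s) 4<m))))
                   (trans (*-congʳ a≈0) (zeroˡ _)))
            (ad≈0⇒c≉0 (a≈0⇒ad≈0 a≈0))))
    ... | no _ | yes b≈0 | _ =
            inj₁ (b≈0 , gap₁-b≈0 (gap≈0 a b c d hyp 0 (ℕ.<-trans (s<s z<s) 4<m)) b≈0)
    ... | no a≉0 | no b≉0 | yes d≈0 = contradiction
            (trans (gap₁ (gap≈0 a b c d hyp 0 (ℕ.<-trans (s<s z<s) 4<m)))
                   (trans (*-congˡ (↑pred-m≈0 d≈0)) (zeroʳ c)))
            (*-≉0 a≉0 (↑-≉0 (ℕ.pred m) b≉0))
    -- No split on c is made, since `consecutive-gaps` asks only for ad and b to be nonzero. The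
    -- split on 3 is there because 4M(M - 1) = 3, so C(m,2) vanishes when 3 does.
    ... | no a≉0 | no b≉0 | no d≉0 with # 3 ≟ 0#
    ...   | no 3≉0 = ⊥-elim (consecutive-gaps 1 binom-m-1≉0 (binom-m-2≉0 3≉0)
              (gap≈0 a b c d hyp 0 (ℕ.<-trans (s<s z<s) 4<m))
              (gap≈0 a b c d hyp 1 (ℕ.<-trans (s<s (s<s z<s)) 4<m))
              (*-≉0 a≉0 d≉0) b≉0)
    ...   | yes 3≈0 with char3 3≈0
    ...     | l , m≡ = ⊥-elim (consecutive-gaps 3
              (λ eq → 1≉0 (trans (sym (binom-4+9-3 3≈0 l))
                (≡.subst (λ n → binom n 3 ≈ 0#) m≡ eq)))
              (λ eq → 1≉0 (trans (sym (binom-4+9-4 3≈0 l))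
                (≡.subst (λ n → binom n 4 ≈ 0#) m≡ eq)))
              (gap≈0 a b c d hyp 2 (ℕ.<-trans (s<s (s<s (s<s z<s))) 4<m))
              (gap≈0 a b c d hyp 3 4<m)
              (*-≉0 a≉0 d≉0) b≉0)

  -- When b^m = d^m, A = ad and B = bc, this is `a * gap i + b * gap (suc i)` scaled by (bd)^(i+1),
  -- with the common factor b · b^m removed.
  bracket : Carrier → Carrier → ℕ → Carrier
  bracket A B i = binom m i * (A * (A ↑ i - B ↑ i)) + binom m (suc i) * (A ↑ suc i - B ↑ suc i)

  bracket-congˡ : ∀ {A A′} B i → A ≈ A′ → bracket A B i ≈ bracket A′ B i
  bracket-congˡ B i A≈A′ = +-cong
    (*-congˡ (*-cong A≈A′ (+-congʳ (↑-cong i A≈A′))))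
    (*-congˡ (+-congʳ (↑-cong (suc i) A≈A′)))

  -- Four times the bracket, with 2M replaced by -1, factors as M(A - B)(A - 3B).
  bracket-1 : ∀ {A B} → bracket A B 1 ≈ 0# → ¬ A - B ≈ 0# → A ≈ # 3 * B
  bracket-1 {A} {B} eq A-B≉0 = x∙y⁻¹≈ε⇒x≈y _ _
    (*-cancel-≈0 (*-cancel-≈0 (by-multiples (# 1) (- (M * (A ↑ 2 - B ↑ 2))) expanded 2M+1≈0
      (solve 3 (λ M A B →
         M :* ((A :- B) :* (A :- con (+ 3) :* B)) :- con (+ 0) :=
         con (+ 1) :* ((con (+ 4) :* (M :* (A :* (A :^ 1 :- B :^ 1))) :+
           con (+ 2) :* (M :* (M :- con (+ 1)) :* (A :^ 2 :- B :^ 2))) :- con (+ 0)) :+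
         (:- (M :* (A :^ 2 :- B :^ 2))) :* ((con (+ 2) :* M :+ con (+ 1)) :- con (+ 0)))
         refl M A B)) M≉0) A-B≉0)
    where
    expanded : # 4 * (M * (A * (A ↑ 1 - B ↑ 1))) + # 2 * (M * (M - # 1) * (A ↑ 2 - B ↑ 2)) ≈ 0#
    expanded = begin
      # 4 * (M * (A * (A ↑ 1 - B ↑ 1))) + # 2 * (M * (M - # 1) * (A ↑ 2 - B ↑ 2))
        ≈⟨ +-cong (*-congˡ (*-congʳ (binom-1 m))) (*-congˡ (*-congʳ (binom-2 m))) ⟨
      # 4 * (binom m 1 * (A * (A ↑ 1 - B ↑ 1))) + # 2 * (# 2 * binom m 2 * (A ↑ 2 - B ↑ 2))
        ≈⟨ solve 4 (λ k l A B →
             con (+ 4) :* (k :* (A :* (A :^ 1 :- B :^ 1))) :+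
             con (+ 2) :* (con (+ 2) :* l :* (A :^ 2 :- B :^ 2)) :=
             con (+ 4) :* (k :* (A :* (A :^ 1 :- B :^ 1)) :+ l :* (A :^ 2 :- B :^ 2)))
             refl (binom m 1) (binom m 2) A B ⟩
      # 4 * bracket A B 1   ≈⟨ *-congˡ eq ⟩
      # 4 * 0#              ≈⟨ zeroʳ _ ⟩
      0#                    ∎

  -- At A = 3B the two differences give 24B³ and 26B³. Multiplying by 12 clears the denominators,
  -- and 2(M - 2) = -5 yields 6 · 24 - 5 · 26 = 14.
  bracket-2 : ∀ {B} → bracket (# 3 * B) B 2 ≈ 0# → M * (M - # 1) * (# 14 * B ↑ 3) ≈ 0#
  bracket-2 {B} eq = by-multiples (# 1) (- (# 26 * (M * (M - # 1) * B ↑ 3))) expanded 2M+1≈0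
    (solve 2 (λ M B →
       M :* (M :- con (+ 1)) :* (con (+ 14) :* B :^ 3) :- con (+ 0) :=
       con (+ 1) :* ((con (+ 6) :* (M :* (M :- con (+ 1)) :* (con (+ 24) :* B :^ 3)) :+
         con (+ 2) :* (M :* (M :- con (+ 1)) :* (M :- con (+ 2)) :* (con (+ 26) :* B :^ 3)))
         :- con (+ 0)) :+
       (:- (con (+ 26) :* (M :* (M :- con (+ 1)) :* B :^ 3))) :*
         ((con (+ 2) :* M :+ con (+ 1)) :- con (+ 0)))
       refl M B)
    where
    expanded : # 6 * (M * (M - # 1) * (# 24 * B ↑ 3)) +
               # 2 * (M * (M - # 1) * (M - # 2) * (# 26 * B ↑ 3)) ≈ 0#
    expanded = begin
      # 6 * (M * (M - # 1) * (# 24 * B ↑ 3)) + # 2 * (M * (M - # 1) * (M - # 2) * (# 26 * B ↑ 3))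
        ≈⟨ +-cong (*-congˡ (*-congʳ (binom-2 m))) (*-congˡ (*-congʳ (binom-3 m))) ⟨
      # 6 * (# 2 * binom m 2 * (# 24 * B ↑ 3)) + # 2 * (# 6 * binom m 3 * (# 26 * B ↑ 3))
        ≈⟨ solve 3 (λ k l B →
             con (+ 6) :* (con (+ 2) :* k :* (con (+ 24) :* B :^ 3)) :+
             con (+ 2) :* (con (+ 6) :* l :* (con (+ 26) :* B :^ 3)) :=
             con (+ 12) :* (k :* (con (+ 3) :* B :* ((con (+ 3) :* B) :^ 2 :- B :^ 2)) :+
                            l :* ((con (+ 3) :* B) :^ 3 :- B :^ 3)))
             refl (binom m 2) (binom m 3) B ⟩
      # 12 * bracket (# 3 * B) B 2   ≈⟨ *-congˡ eq ⟩
      # 12 * 0#                      ≈⟨ zeroʳ _ ⟩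
      0#                             ∎

  -- The same with factor 48 and 2(M - 3) = -7: 8 · 78 - 7 · 80 = 64.
  bracket-3 : ∀ {B} → bracket (# 3 * B) B 3 ≈ 0# →
              M * (M - # 1) * (M - # 2) * (# 64 * B ↑ 4) ≈ 0#
  bracket-3 {B} eq =
    by-multiples (# 1) (- (# 80 * (M * (M - # 1) * (M - # 2) * B ↑ 4))) expanded 2M+1≈0
    (solve 2 (λ M B →
       M :* (M :- con (+ 1)) :* (M :- con (+ 2)) :* (con (+ 64) :* B :^ 4) :- con (+ 0) :=
       con (+ 1) :* ((con (+ 8) :* (M :* (M :- con (+ 1)) :* (M :- con (+ 2)) :* (con (+ 78) :* B :^ 4)) :+
         con (+ 2) :* (M :* (M :- con (+ 1)) :* (M :- con (+ 2)) :* (M :- con (+ 3)) :*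
           (con (+ 80) :* B :^ 4)))
         :- con (+ 0)) :+
       (:- (con (+ 80) :* (M :* (M :- con (+ 1)) :* (M :- con (+ 2)) :* B :^ 4))) :*
         ((con (+ 2) :* M :+ con (+ 1)) :- con (+ 0)))
       refl M B)
    where
    expanded : # 8 * (M * (M - # 1) * (M - # 2) * (# 78 * B ↑ 4)) +
               # 2 * (M * (M - # 1) * (M - # 2) * (M - # 3) * (# 80 * B ↑ 4)) ≈ 0#
    expanded = begin
      # 8 * (M * (M - # 1) * (M - # 2) * (# 78 * B ↑ 4)) +
      # 2 * (M * (M - # 1) * (M - # 2) * (M - # 3) * (# 80 * B ↑ 4))
        ≈⟨ +-cong (*-congˡ (*-congʳ (binom-3 m))) (*-congˡ (*-congʳ (binom-4 m))) ⟨
      # 8 * (# 6 * binom m 3 * (# 78 * B ↑ 4)) + # 2 * (# 24 * binom m 4 * (# 80 * B ↑ 4))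
        ≈⟨ solve 3 (λ k l B →
             con (+ 8) :* (con (+ 6) :* k :* (con (+ 78) :* B :^ 4)) :+
             con (+ 2) :* (con (+ 24) :* l :* (con (+ 80) :* B :^ 4)) :=
             con (+ 48) :* (k :* (con (+ 3) :* B :* ((con (+ 3) :* B) :^ 3 :- B :^ 3)) :+
                            l :* ((con (+ 3) :* B) :^ 4 :- B :^ 4)))
             refl (binom m 3) (binom m 4) B ⟩
      # 48 * bracket (# 3 * B) B 3   ≈⟨ *-congˡ eq ⟩
      # 48 * 0#                      ≈⟨ zeroʳ _ ⟩
      0#                             ∎

  -- A = 3B with A ≠ 0 makes 3 and B nonzero, hence M - 1 nonzero and 14 = 0. Then 3 · 5 - 14 = 1
  -- and 2 · 64 - 9 · 14 = 2 show that 5 and 64 are nonzero, which contradicts the third bracket.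
  brackets≉0 : ∀ {A B} → ¬ A ≈ 0# → ¬ A - B ≈ 0# →
               (∀ i → suc i < 4 → bracket A B (suc i) ≈ 0#) → ⊥
  brackets≉0 {A} {B} A≉0 A-B≉0 eq =
    *-≉0 (*-≉0 (*-≉0 M≉0 (M-1≉0 3≉0)) (M-2≉0 5≉0)) (*-≉0 64≉0 (↑-≉0 4 B≉0))
      (bracket-3 (trans (sym (bracket-congˡ B 3 A≈3B)) (eq 2 (s<s (s<s (s<s z<s))))))
    where
    A≈3B : A ≈ # 3 * B
    A≈3B = bracket-1 (eq 0 (s<s z<s)) A-B≉0

    3≉0 : ¬ # 3 ≈ 0#
    3≉0 3≈0 = A≉0 (trans A≈3B (trans (*-congʳ 3≈0) (zeroˡ B)))

    B≉0 : ¬ B ≈ 0#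
    B≉0 B≈0 = A≉0 (trans A≈3B (trans (*-congˡ B≈0) (zeroʳ _)))

    14≈0 : # 14 ≈ 0#
    14≈0 = *-cancel-≈0
      (trans (*-comm _ _) (*-cancel-≈0
        (bracket-2 (trans (sym (bracket-congˡ B 2 A≈3B)) (eq 1 (s<s (s<s z<s)))))
        (*-≉0 M≉0 (M-1≉0 3≉0))))
      (↑-≉0 3 B≉0)

    5≉0 : ¬ # 5 ≈ 0#
    5≉0 5≈0 = #1≉0 (by-multiples (# 3) (- # 1) 5≈0 14≈0
      (solve 0 (con (+ 1) :- con (+ 0) :=
         con (+ 3) :* (con (+ 5) :- con (+ 0)) :+ (:- con (+ 1)) :* (con (+ 14) :- con (+ 0)))
         refl))

    64≉0 : ¬ # 64 ≈ 0#
    64≉0 64≈0 = #2≉0 (by-multiples (# 2) (- # 9) 64≈0 14≈0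
      (solve 0 (con (+ 2) :- con (+ 0) :=
         con (+ 2) :* (con (+ 64) :- con (+ 0)) :+ (:- con (+ 9)) :* (con (+ 14) :- con (+ 0)))
         refl))

  module _ {a b c d : Carrier} (det≉0 : ¬ a * d - b * c ≈ 0#) where

    module _ (constant : b * (b ↑ m - d ↑ m) ≈ 0#)
             (gaps≈0 : ∀ i → suc i < m →
                       a * gap a b c d (suc i) + b * gap a b c d (suc (suc i)) ≈ 0#)
             (a≉0 : ¬ a ≈ 0#) where

      linear-gaps-b≈0 : b ≈ 0# → c ≈ 0#
      linear-gaps-b≈0 b≈0 = gap₁-b≈0 det≉0 (*-cancel-≈0 (begin
        a * gap a b c d 1
          ≈⟨ +-identityʳ _ ⟨
        a * gap a b c d 1 + 0#
          ≈⟨ +-congˡ (trans (*-congʳ b≈0) (zeroˡ _)) ⟨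
        a * gap a b c d 1 + b * gap a b c d 2
          ≈⟨ gaps≈0 0 (ℕ.<-trans (s<s z<s) 4<m) ⟩
        0# ∎) a≉0) b≈0

      linear-gaps-b≉0 : ¬ b ≈ 0# → ⊥
      linear-gaps-b≉0 b≉0 = brackets≉0 (*-≉0 a≉0 d≉0) det≉0
        (λ i 1+i<4 → bracket≈0 (suc i) (gaps≈0 i (ℕ.<-trans 1+i<4 4<m)))
        where
        bᵐ≈dᵐ : b ↑ m ≈ d ↑ m
        bᵐ≈dᵐ = x∙y⁻¹≈ε⇒x≈y _ _ (*-cancel-≈0 constant b≉0)

        d≉0 : ¬ d ≈ 0#
        d≉0 d≈0 = ↑-≉0 m b≉0 (trans bᵐ≈dᵐ (trans (↑-cong m d≈0) (0↑n≈0 m 0<m)))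
          where
          0↑n≈0 : ∀ n → 0 < n → 0# ↑ n ≈ 0#
          0↑n≈0 (suc n) _ = zeroˡ _

        gap-factor : ∀ i → gap a b c d i * (b ↑ i * d ↑ i) ≈
                           binom m i * ((a * d) ↑ i - (b * c) ↑ i) * b ↑ m
        gap-factor i = begin
          gap a b c d i * (b ↑ i * d ↑ i)
            ≈⟨ gap-binom a b c d i ⟩
          binom m i * ((a * d) ↑ i * b ↑ m - (b * c) ↑ i * d ↑ m)
            ≈⟨ *-congˡ (+-congˡ (-‿cong (*-congˡ bᵐ≈dᵐ))) ⟨
          binom m i * ((a * d) ↑ i * b ↑ m - (b * c) ↑ i * b ↑ m)
            ≈⟨ solve 4 (λ k u v w → k :* (u :* w :- v :* w) := k :* (u :- v) :* w) refl
                 (binom m i) ((a * d) ↑ i) ((b * c) ↑ i) (b ↑ m) ⟩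
          binom m i * ((a * d) ↑ i - (b * c) ↑ i) * b ↑ m ∎

        bracket≈0 : ∀ i → a * gap a b c d i + b * gap a b c d (suc i) ≈ 0# →
                    bracket (a * d) (b * c) i ≈ 0#
        bracket≈0 i eq = *-cancel-≈0 (begin
          (b * b ↑ m) * bracket (a * d) (b * c) i
            ≈⟨ solve 7 (λ A b w k k′ D D′ →
                 (b :* w) :* (k :* (A :* D) :+ k′ :* D′) :=
                 b :* (A :* (k :* D :* w)) :+ b :* (k′ :* D′ :* w)) refl
                 (a * d) b (b ↑ m) (binom m i) (binom m (suc i))
                 ((a * d) ↑ i - (b * c) ↑ i) ((a * d) ↑ suc i - (b * c) ↑ suc i) ⟩
          b * ((a * d) * (binom m i * ((a * d) ↑ i - (b * c) ↑ i) * b ↑ m)) +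
          b * (binom m (suc i) * ((a * d) ↑ suc i - (b * c) ↑ suc i) * b ↑ m)
            ≈⟨ +-cong (*-congˡ (*-congˡ (gap-factor i))) (*-congˡ (gap-factor (suc i))) ⟨
          b * ((a * d) * (gap a b c d i * (b ↑ i * d ↑ i))) +
          b * (gap a b c d (suc i) * (b ↑ suc i * d ↑ suc i))
            ≈⟨ solve 7 (λ a b d g g′ u v →
                 b :* ((a :* d) :* (g :* (u :* v))) :+ b :* (g′ :* ((b :* u) :* (d :* v))) :=
                 (a :* g :+ b :* g′) :* ((b :* u) :* (d :* v))) refl
                 a b d (gap a b c d i) (gap a b c d (suc i)) (b ↑ i) (d ↑ i) ⟩
          (a * gap a b c d i + b * gap a b c d (suc i)) * (b ↑ suc i * d ↑ suc i)
            ≈⟨ *-congʳ eq ⟩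
          0# * (b ↑ suc i * d ↑ suc i)
            ≈⟨ zeroˡ _ ⟩
          0# ∎) (*-≉0 b≉0 (↑-≉0 m b≉0))

    linear-gaps≈0⇒diagonal : ¬ a ≈ 0# →
      (∀ y → (a * (y * y) + b) * ((a * (y * y) + b) ↑ m - (c * (y * y) + d) ↑ m) ≈ 0#) →
      b ≈ 0# × c ≈ 0#
    linear-gaps≈0⇒diagonal a≉0 hyp = b≈0 , linear-gaps-b≈0 constant gaps≈0 a≉0 b≈0
      where
      constant = proj₁ (linear-gap a b c d hyp)
      gaps≈0   = proj₂ (linear-gap a b c d hyp)
      b≈0      = decidable-stable (b ≟ 0#) (linear-gaps-b≉0 constant gaps≈0 a≉0)

-- Squares, and fractional linear maps on the projective line.

module ProjectiveLine {q : ℕ} (F : FiniteField q) where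
  open FiniteField F hiding (zero)
  open FieldProperties F
  open IntegerCoefficients cring
  open Solver using (solve; _:=_; _:*_; _:-_; con)
  open Relation.Binary.Reasoning.Setoid setoid
  open PGLElt

  ≈P-sym : ∀ x y → _≈P_ F x y → _≈P_ F y x
  ≈P-sym nothing  nothing  _   = tt
  ≈P-sym (just x) (just y) x≈y = sym x≈y

  ≈P-trans : ∀ x y z → _≈P_ F x y → _≈P_ F y z → _≈P_ F x z
  ≈P-trans nothing  nothing  nothing  _   _   = tt
  ≈P-trans (just x) (just y) (just z) x≈y y≈z = trans x≈y y≈z

  Respects≈P : (P1 F → Set) → Set
  Respects≈P S = ∀ x y → _≈P_ F x y → S x → S y

  IsQ-cong : ∀ {x y} → x ≈ y → IsQ F x → IsQ F y
  IsQ-cong x≈y (x≉0 , z , zz≈x) = x≉0 ∘ trans x≈y , z , trans zz≈x x≈y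

  IsQ-square : ∀ {y} → ¬ y ≈ 0# → IsQ F (y * y)
  IsQ-square {y} y≉0 = *-≉0 y≉0 y≉0 , y , refl

  IsQ-root≉0 : ∀ {x} ((_ , y , _) : IsQ F x) → ¬ y ≈ 0#
  IsQ-root≉0 (x≉0 , y , yy≈x) y≈0 = x≉0 (trans (sym yy≈x) (trans (*-congʳ y≈0) (zeroˡ y)))

  IsQ-1 : IsQ F 1#
  IsQ-1 = 1≉0 , 1# , *-identityˡ 1#

  IsQ-* : ∀ {x y} → IsQ F x → IsQ F y → IsQ F (x * y)
  IsQ-* (x≉0 , u , uu≈x) (y≉0 , v , vv≈y) =
    *-≉0 x≉0 y≉0 , u * v ,
    trans (solve 2 (λ u v → (u :* v) :* (u :* v) := (u :* u) :* (v :* v)) refl u v) (*-cong uu≈x vv≈y)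

  IsQ-⁻¹ : ∀ {x} → IsQ F x → IsQ F (x ⁻¹)
  IsQ-⁻¹ {x} x∈Q@(x≉0 , y , yy≈x) = ⁻¹-≉0 x≉0 , y ⁻¹ , *-cancelˡ x≉0 (begin
    x * (y ⁻¹ * y ⁻¹)           ≈⟨ *-congʳ yy≈x ⟨
    (y * y) * (y ⁻¹ * y ⁻¹)
      ≈⟨ solve 2 (λ y z → (y :* y) :* (z :* z) := (y :* z) :* (y :* z)) refl y (y ⁻¹) ⟩
    (y * y ⁻¹) * (y * y ⁻¹)     ≈⟨ *-cong yy⁻¹≈1 yy⁻¹≈1 ⟩
    1# * 1#                     ≈⟨ *-identityˡ 1# ⟩
    1#                          ≈⟨ ⁻¹-inv x x≉0 ⟨
    x * x ⁻¹                    ∎)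
    where
    yy⁻¹≈1 = ⁻¹-inv y (IsQ-root≉0 x∈Q)

  𝒬-resp : Respects≈P (𝒬 F)
  𝒬-resp (just _) (just _) = IsQ-cong

  V₀-resp : Respects≈P (V₀ F)
  V₀-resp (just _) (just _) x≈y = ⊎.map (IsQ-cong x≈y) (trans (sym x≈y))

  U₀-resp : Respects≈P (U₀ F)
  U₀-resp nothing  nothing  _ _ = tt
  U₀-resp (just _) (just _) = IsQ-cong

  V₀-* : ∀ {e x} → IsQ F e → V₀ F (just x) → V₀ F (just (e * x))
  V₀-* e∈Q (inj₁ x∈Q) = inj₁ (IsQ-* e∈Q x∈Q)
  V₀-* e∈Q (inj₂ x≈0) = inj₂ (trans (*-congˡ x≈0) (zeroʳ _))

  *-⁻¹-* : ∀ {e} y → ¬ e ≈ 0# → e * (e ⁻¹ * y) ≈ y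
  *-⁻¹-* {e} y e≉0 = trans (sym (*-assoc _ _ _)) (trans (*-congʳ (⁻¹-inv e e≉0)) (*-identityˡ y))

  -- One argument serves all three sets: a scaling fixes ∞ whether or not it lies in S, and
  -- preimages come from e⁻¹, again a square.
  scaling-stabilises : ∀ {S} → Respects≈P S →
    (∀ {e x} → IsQ F e → S (just x) → S (just (e * x))) →
    ∀ g → IsScaling F g → Stabilises F g S
  scaling-stabilises {S} resp S-* g (e , e∈Q , eq) = into , onto
    where
    into : ∀ x → S x → S (act F g x)
    into (just x) x∈S = resp (just (e * x)) (act F g (just x))
      (≈P-sym (act F g (just x)) (just (e * x)) (eq (just x))) (S-* e∈Q x∈S)
    into nothing  ∞∈S = resp nothing (act F g nothing)
      (≈P-sym (act F g nothing) nothing (eq nothing)) ∞∈S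

    onto : ∀ y → S y → ∃ λ x → S x × _≈P_ F (act F g x) y
    onto (just y) y∈S = just (e ⁻¹ * y) , S-* (IsQ-⁻¹ e∈Q) y∈S ,
      ≈P-trans (act F g (just (e ⁻¹ * y))) (just (e * (e ⁻¹ * y))) (just y)
        (eq (just (e ⁻¹ * y))) (*-⁻¹-* y (proj₁ e∈Q))
    onto nothing ∞∈S = nothing , ∞∈S , eq nothing

  inversion-stabilises : ∀ g → IsInversion F g → Stabilises F g (𝒬 F)
  inversion-stabilises g (e , e∈Q , eq) = into , onto
    where
    eq-nonzero : ∀ {x} → ¬ x ≈ 0# → _≈P_ F (act F g (just x)) (just (e * x ⁻¹))
    -- `inv` is local to `IsInversion`; abstracting `x ≟ 0#` makes it reduce in the type of
    -- `eq (just x)`.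
    eq-nonzero {x} x≉0 with x ≟ 0# | eq (just x)
    ... | yes x≈0 | _   = contradiction x≈0 x≉0
    ... | no  _   | eq′ = eq′

    into : ∀ x → 𝒬 F x → 𝒬 F (act F g x)
    into (just x) x∈Q@(x≉0 , _) =
      𝒬-resp (just (e * x ⁻¹)) (act F g (just x))
        (≈P-sym (act F g (just x)) (just (e * x ⁻¹)) (eq-nonzero x≉0)) (IsQ-* e∈Q (IsQ-⁻¹ x∈Q))

    onto : ∀ y → 𝒬 F y → ∃ λ x → 𝒬 F x × _≈P_ F (act F g x) y
    onto (just y) y∈Q@(y≉0 , _) = just (e * y ⁻¹) , ey⁻¹∈Q ,
      ≈P-trans (act F g (just (e * y ⁻¹))) (just (e * (e * y ⁻¹) ⁻¹)) (just y)
        (eq-nonzero (proj₁ ey⁻¹∈Q)) (divide (proj₁ ey⁻¹∈Q) (begin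
          e                  ≈⟨ *-identityʳ e ⟨
          e * 1#             ≈⟨ *-congˡ (⁻¹-inv y y≉0) ⟨
          e * (y * y ⁻¹)     ≈⟨ solve 3 (λ e y z → e :* (y :* z) := y :* (e :* z)) refl e y (y ⁻¹) ⟩
          y * (e * y ⁻¹)     ∎))
      where
      ey⁻¹∈Q = IsQ-* e∈Q (IsQ-⁻¹ y∈Q)

  -- The value w is characterised without division, so that its uses reduce to ring identities.
  act-finite : ∀ g {x w} → ¬ c g * x + d g ≈ 0# → a g * x + b g ≈ w * (c g * x + d g) →
               _≈P_ F (act F g (just x)) (just w)
  act-finite (mat a b c d _) {x} v≉0 u≈wv with (c * x + d) ≟ 0#
  ... | yes v≈0 = contradiction v≈0 v≉0
  ... | no  _   = divide v≉0 u≈wv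

  act-pole : ∀ g {x} → c g * x + d g ≈ 0# → _≈P_ F (act F g (just x)) nothing
  act-pole (mat a b c d _) {x} v≈0 with (c * x + d) ≟ 0#
  ... | yes _   = tt
  ... | no  v≉0 = contradiction v≈0 v≉0

  act-∞-pole : ∀ g → c g ≈ 0# → _≈P_ F (act F g nothing) nothing
  act-∞-pole (mat a b c d _) c≈0 with c ≟ 0#
  ... | yes _   = tt
  ... | no  c≉0 = contradiction c≈0 c≉0

  act-∞-finite : ∀ g {w} → ¬ c g ≈ 0# → a g ≈ w * c g → _≈P_ F (act F g nothing) (just w)
  act-∞-finite (mat a b c d _) c≉0 a≈wc with c ≟ 0#
  ... | yes c≈0 = contradiction c≈0 c≉0
  ... | no  _   = divide c≉0 a≈wc

  degenerate-column : (g : PGLElt F) → a g ≈ 0# → b g ≈ 0# → ⊥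
  degenerate-column g a≈0 b≈0 = det≉0 g (trans (+-cong (*-congʳ a≈0) (-‿cong (*-congʳ b≈0)))
    (solve 2 (λ c d → con (+ 0) :* d :- con (+ 0) :* c := con (+ 0)) refl (c g) (d g)))

  degenerate-pole : (g : PGLElt F) → c g ≈ 0# → d g ≈ 0# → ⊥
  degenerate-pole g c≈0 d≈0 = det≉0 g (trans (+-cong (*-congˡ d≈0) (-‿cong (*-congˡ c≈0)))
    (solve 2 (λ a b → a :* con (+ 0) :- b :* con (+ 0) := con (+ 0)) refl (a g) (b g)))

  0x+y≈y : ∀ {z} x y → z ≈ 0# → z * x + y ≈ y
  0x+y≈y x y z≈0 = trans (+-congʳ (trans (*-congʳ z≈0) (zeroˡ x))) (+-identityˡ y)

  zx+0≈zx : ∀ {y} z x → y ≈ 0# → z * x + y ≈ z * x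
  zx+0≈zx z x y≈0 = trans (+-congˡ y≈0) (+-identityʳ _)

  module _ (g : PGLElt F) where

    module _ (b≈0 : b g ≈ 0#) (c≈0 : c g ≈ 0#) where

      private
        e = a g * d g ⁻¹

        d≉0 : ¬ d g ≈ 0#
        d≉0 = degenerate-pole g c≈0

        a≉0 : ¬ a g ≈ 0#
        a≉0 a≈0 = degenerate-column g a≈0 b≈0

      act-diagonal : ∀ x → _≈P_ F (act F g (just x)) (just (e * x))
      act-diagonal x = act-finite g
        (λ v≈0 → d≉0 (trans (sym (0x+y≈y x (d g) c≈0)) v≈0))
        (begin
          a g * x + b g          ≈⟨ zx+0≈zx (a g) x b≈0 ⟩
          a g * x                ≈⟨ *-congʳ (undivide d≉0) ⟨
          e * d g * x            ≈⟨ solve 3 (λ e d x → e :* d :* x := e :* x :* d) refl e (d g) x ⟩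
          e * x * d g            ≈⟨ *-congˡ (0x+y≈y x (d g) c≈0) ⟨
          e * x * (c g * x + d g) ∎)

      -- The ratio a/d is the image of 1 and therefore lies in S. `S⇒Q` is asked only away from 0,
      -- so that V₀ qualifies.
      diagonal-scaling : ∀ {S} → Respects≈P S → S (just 1#) →
        (∀ {x} → ¬ x ≈ 0# → S (just x) → IsQ F x) → Stabilises F g S → IsScaling F g
      diagonal-scaling resp 1∈S S⇒Q (into , _) =
        e , IsQ-cong (*-identityʳ e)
              (S⇒Q (*-≉0 (*-≉0 a≉0 (⁻¹-≉0 d≉0)) 1≉0)
                (resp (act F g (just 1#)) (just (e * 1#)) (act-diagonal 1#) (into (just 1#) 1∈S))) ,
        λ where
          (just x) → act-diagonal x
          nothing  → act-∞-pole g c≈0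

    module _ (a≈0 : a g ≈ 0#) (d≈0 : d g ≈ 0#) where

      private
        e = b g * c g ⁻¹

        c≉0 : ¬ c g ≈ 0#
        c≉0 c≈0 = degenerate-pole g c≈0 d≈0

      act-antidiagonal : ∀ {x} → ¬ x ≈ 0# → _≈P_ F (act F g (just x)) (just (e * x ⁻¹))
      act-antidiagonal {x} x≉0 = act-finite g
        (λ v≈0 → *-≉0 c≉0 x≉0 (trans (sym (zx+0≈zx (c g) x d≈0)) v≈0))
        (begin
          a g * x + b g                    ≈⟨ 0x+y≈y x (b g) a≈0 ⟩
          b g                              ≈⟨ undivide c≉0 ⟨
          e * c g                          ≈⟨ *-identityʳ _ ⟨
          e * c g * 1#                     ≈⟨ *-congˡ (⁻¹-inv x x≉0) ⟨
          e * c g * (x * x ⁻¹)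
            ≈⟨ solve 4 (λ e c x z → e :* c :* (x :* z) := e :* z :* (c :* x)) refl e (c g) x (x ⁻¹) ⟩
          e * x ⁻¹ * (c g * x)             ≈⟨ *-congˡ (zx+0≈zx (c g) x d≈0) ⟨
          e * x ⁻¹ * (c g * x + d g)       ∎)

      antidiagonal-inversion : Stabilises F g (𝒬 F) → IsInversion F g
      antidiagonal-inversion (into , _) = e , e∈Q , eq
        where
        e∈Q : IsQ F e
        e∈Q = IsQ-cong (divide 1≉0 (sym (*-identityʳ e)))
          (𝒬-resp (act F g (just 1#)) (just (e * 1# ⁻¹)) (act-antidiagonal 1≉0)
            (into (just 1#) IsQ-1))

        -- The codomain is left to inference because it involves the map `inv` local to
        -- `IsInversion`.
        eq : ∀ x → _
        eq nothing  = act-∞-finite g c≉0 (trans a≈0 (sym (zeroˡ (c g))))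
        eq (just x) with x ≟ 0#
        ... | yes x≈0 = act-pole g (trans (zx+0≈zx (c g) x d≈0) (trans (*-congˡ x≈0) (zeroʳ (c g))))
        ... | no  x≉0 = act-antidiagonal x≉0

-- From stabilising a set to power identities, and the three stabilisers.

module Stabilisers {m : ℕ} (F : FiniteField (suc (m ℕ.* 2))) (4<m : 4 < m) where
  open FiniteField F hiding (zero)
  open FieldProperties F
  open OddOrder {m} F
  open Rigidity {m} F 4<m
  open ProjectiveLine F
  open IntegerCoefficients cring
  open Solver using (solve; _:=_; _:+_; _:*_; _:-_; con)
  open Algebra.Properties.Semiring.Exp semiring using () renaming (_^_ to _↑_)
  open Algebra.Properties.CommutativeSemiring.Exp commutativeSemiring using (^-distrib-*)
  open Algebra.Properties.AbelianGroup +-abelianGroup using (x≈y⇒x∙y⁻¹≈ε)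
  open Relation.Binary.Reasoning.Setoid setoid
  open PGLElt

  ratio-↑m : ∀ {u v} → ¬ v ≈ 0# → IsQ F (u * v ⁻¹) → u ↑ m ≈ v ↑ m
  ratio-↑m {u} {v} v≉0 uv⁻¹∈Q@(_ , y , yy≈uv⁻¹) = begin
    u ↑ m                       ≈⟨ ↑-cong m (undivide v≉0) ⟨
    ((u * v ⁻¹) * v) ↑ m        ≈⟨ ↑-cong m (*-congʳ yy≈uv⁻¹) ⟨
    ((y * y) * v) ↑ m           ≈⟨ ^-distrib-* (y * y) v m ⟩
    (y * y) ↑ m * v ↑ m         ≈⟨ *-congʳ (square-↑m (IsQ-root≉0 uv⁻¹∈Q)) ⟩
    1# * v ↑ m                  ≈⟨ *-identityˡ _ ⟩
    v ↑ m                       ∎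

  -- For V₀, u is the numerator, and for U₀ the denominator. The factor u absorbs the one permitted
  -- image that is not a nonzero square, 0 or ∞ respectively, and keeps the condition polynomial.
  PowersAgree : Carrier → Carrier → Set
  PowersAgree u v = u * (u ↑ m - v ↑ m) ≈ 0#

  powersAgree : ∀ {u v} → u ↑ m ≈ v ↑ m → PowersAgree u v
  powersAgree eq = trans (*-congˡ (x≈y⇒x∙y⁻¹≈ε eq)) (zeroʳ _)

  powersAgree-0 : ∀ {u v} → u ≈ 0# → PowersAgree u v
  powersAgree-0 u≈0 = trans (*-congʳ u≈0) (zeroˡ _)

  numerator≈0 : ∀ {u v} → ¬ v ≈ 0# → u * v ⁻¹ ≈ 0# → u ≈ 0#
  numerator≈0 v≉0 uv⁻¹≈0 = *-cancel-≈0 (trans (*-comm _ _) uv⁻¹≈0) (⁻¹-≉0 v≉0)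

  act∈𝒬 : ∀ g x → 𝒬 F (act F g (just x)) → (a g * x + b g) ↑ m ≈ (c g * x + d g) ↑ m
  act∈𝒬 (mat a b c d _) x gx∈Q with (c * x + d) ≟ 0#
  ... | no v≉0 = ratio-↑m v≉0 gx∈Q

  act∈V₀ : ∀ g x → V₀ F (act F g (just x)) → PowersAgree (a g * x + b g) (c g * x + d g)
  act∈V₀ (mat a b c d _) x gx∈V with (c * x + d) ≟ 0#
  act∈V₀ (mat a b c d _) x (inj₁ gx∈Q) | no v≉0 = powersAgree (ratio-↑m v≉0 gx∈Q)
  act∈V₀ (mat a b c d _) x (inj₂ gx≈0) | no v≉0 = powersAgree-0 (numerator≈0 v≉0 gx≈0)

  act∈U₀ : ∀ g x → U₀ F (act F g (just x)) → PowersAgree (c g * x + d g) (a g * x + b g)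
  act∈U₀ (mat a b c d _) x gx∈U with (c * x + d) ≟ 0#
  ... | yes v≈0 = powersAgree-0 v≈0
  ... | no  v≉0 = powersAgree (sym (ratio-↑m v≉0 gx∈U))

  act∞∈U₀ : ∀ g → U₀ F (act F g nothing) → PowersAgree (c g) (a g)
  act∞∈U₀ (mat a b c d _) g∞∈U with c ≟ 0#
  ... | yes c≈0 = powersAgree-0 c≈0
  ... | no  c≉0 = powersAgree (sym (ratio-↑m c≉0 g∞∈U))

  act≈0 : ∀ g x → _≈P_ F (act F g (just x)) (just 0#) → a g * x + b g ≈ 0#
  act≈0 (mat a b c d _) x gx≈0 with (c * x + d) ≟ 0#
  ... | no v≉0 = numerator≈0 v≉0 gx≈0

  act≈∞ : ∀ g x → _≈P_ F (act F g (just x)) nothing → c g * x + d g ≈ 0#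
  act≈∞ (mat a b c d _) x gx≈∞ with (c * x + d) ≟ 0#
  ... | yes v≈0 = v≈0

  act∞≈∞ : ∀ g → _≈P_ F (act F g nothing) nothing → c g ≈ 0#
  act∞≈∞ (mat a b c d _) g∞≈∞ with c ≟ 0#
  ... | yes c≈0 = c≈0

  stabilises-𝒬⇒monomial : (# 3 ≈ 0# → ∃ λ l → m ≡ 4 ℕ.+ l ℕ.* 9) →
    (g : PGLElt F) → Stabilises F g (𝒬 F) → (b g ≈ 0# × c g ≈ 0#) ⊎ (a g ≈ 0# × d g ≈ 0#)
  stabilises-𝒬⇒monomial char3 g (into , _) = gaps≈0⇒monomial (det≉0 g) char3
    (λ {y} y≉0 → act∈𝒬 g (y * y) (into (just (y * y)) (IsQ-square y≉0)))

  stabilises-V₀⇒diagonal : (g : PGLElt F) → Stabilises F g (V₀ F) → b g ≈ 0# × c g ≈ 0#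
  stabilises-V₀⇒diagonal g (into , onto) =
    linear-gaps≈0⇒diagonal (det≉0 g) a≉0 (λ y → act∈V₀ g (y * y) (into (just (y * y)) (yy∈V y)))
    where
    yy∈V : ∀ y → V₀ F (just (y * y))
    yy∈V y with y ≟ 0#
    ... | yes y≈0 = inj₂ (trans (*-congʳ y≈0) (zeroˡ y))
    ... | no  y≉0 = inj₁ (IsQ-square y≉0)

    -- If a = 0 then no finite point maps to 0, and ∞ is not in V₀.
    a≉0 : ¬ a g ≈ 0#
    a≉0 a≈0 with onto (just 0#) (inj₂ refl)
    ... | just x , _ , gx≈0 =
      degenerate-column g a≈0 (trans (sym (0x+y≈y x (b g) a≈0)) (act≈0 g x gx≈0))

  -- With x = 1/y the condition for U₀ becomes the condition for V₀
  -- on the matrix with rows (d , c) and (b , a).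
  stabilises-U₀⇒diagonal : (g : PGLElt F) → Stabilises F g (U₀ F) → c g ≈ 0# × b g ≈ 0#
  stabilises-U₀⇒diagonal g (into , onto) = linear-gaps≈0⇒diagonal det′≉0 d≉0 powers
    where
    det′≉0 : ¬ d g * a g - c g * b g ≈ 0#
    det′≉0 = det≉0 g ∘ trans (+-cong (*-comm _ _) (-‿cong (*-comm _ _)))

    -- If d = 0 then c ≠ 0 and only 0 maps to ∞, but 0 is not in U₀.
    d≉0 : ¬ d g ≈ 0#
    d≉0 d≈0 with onto nothing tt
    ... | nothing , _ , g∞≈∞ = degenerate-pole g (act∞≈∞ g g∞≈∞) d≈0
    ... | just x , (x≉0 , _) , gx≈∞ = degenerate-pole g
      (*-cancel-≈0 (trans (*-comm x (c g))
        (trans (sym (zx+0≈zx (c g) x d≈0)) (act≈∞ g x gx≈∞))) x≉0)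
      d≈0

    -- The condition is homogeneous of degree m + 1 in (u, v), so the denominator y² can be cleared.
    powersAgree-scale : ∀ {u v u′ v′} w → u′ ≈ w * u → v′ ≈ w * v →
                        PowersAgree u v → PowersAgree u′ v′
    powersAgree-scale {u} {v} {u′} {v′} w u′≈wu v′≈wv agree = begin
      u′ * (u′ ↑ m - v′ ↑ m)
        ≈⟨ *-cong u′≈wu (+-cong (trans (↑-cong m u′≈wu) (^-distrib-* w u m))
                                (-‿cong (trans (↑-cong m v′≈wv) (^-distrib-* w v m)))) ⟩
      (w * u) * (w ↑ m * u ↑ m - w ↑ m * v ↑ m)
        ≈⟨ solve 5 (λ w u p r s → (w :* u) :* (p :* r :- p :* s) := (w :* p) :* (u :* (r :- s))) refl
             w u (w ↑ m) (u ↑ m) (v ↑ m) ⟩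
      (w * w ↑ m) * (u * (u ↑ m - v ↑ m))
        ≈⟨ *-congˡ agree ⟩
      (w * w ↑ m) * 0#
        ≈⟨ zeroʳ _ ⟩
      0# ∎

    reciprocal : ∀ {y} → ¬ y ≈ 0# → ∀ s t → t * (y * y) + s ≈ (y * y) * (s * (y ⁻¹ * y ⁻¹) + t)
    reciprocal {y} y≉0 s t = begin
      t * (y * y) + s                  ≈⟨ +-congˡ (*-identityʳ s) ⟨
      t * (y * y) + s * 1#             ≈⟨ +-congˡ (*-congˡ (*-identityˡ 1#)) ⟨
      t * (y * y) + s * (1# * 1#)      ≈⟨ +-congˡ (*-congˡ (*-cong (⁻¹-inv y y≉0) (⁻¹-inv y y≉0))) ⟨
      t * (y * y) + s * ((y * y ⁻¹) * (y * y ⁻¹))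
        ≈⟨ solve 4 (λ s t y z → t :* (y :* y) :+ s :* ((y :* z) :* (y :* z)) :=
                                (y :* y) :* (s :* (z :* z) :+ t)) refl s t y (y ⁻¹) ⟩
      (y * y) * (s * (y ⁻¹ * y ⁻¹) + t) ∎

    at-0 : ∀ {y} s t → y ≈ 0# → t * (y * y) + s ≈ 1# * s
    at-0 {y} s t y≈0 = begin
      t * (y * y) + s   ≈⟨ +-congʳ (*-congˡ (trans (*-congʳ y≈0) (zeroˡ y))) ⟩
      t * 0# + s        ≈⟨ trans (+-congʳ (zeroʳ t)) (+-identityˡ s) ⟩
      s                 ≈⟨ *-identityˡ s ⟨
      1# * s            ∎

    powers : ∀ y → PowersAgree (d g * (y * y) + c g) (b g * (y * y) + a g)
    powers y with y ≟ 0#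
    -- y = 0 stands for the point ∞, whose image is governed by a and c.
    ... | yes y≈0 = powersAgree-scale 1# (at-0 (c g) (d g) y≈0) (at-0 (a g) (b g) y≈0)
                      (act∞∈U₀ g (into nothing tt))
    ... | no  y≉0 = powersAgree-scale (y * y) (reciprocal y≉0 (c g) (d g)) (reciprocal y≉0 (a g) (b g))
                      (act∈U₀ g (y ⁻¹ * y ⁻¹)
                        (into (just (y ⁻¹ * y ⁻¹)) (IsQ-square (⁻¹-≉0 y≉0))))

  𝒬-stabiliser : (# 3 ≈ 0# → ∃ λ l → m ≡ 4 ℕ.+ l ℕ.* 9) →
                 (g : PGLElt F) → Stabilises F g (𝒬 F) ⇔ (IsScaling F g ⊎ IsInversion F g)
  𝒬-stabiliser char3 g = mk⇔
    (λ st → ⊎.map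
      (λ (b≈0 , c≈0) → diagonal-scaling g b≈0 c≈0 𝒬-resp IsQ-1 (λ _ x∈Q → x∈Q) st)
      (λ (a≈0 , d≈0) → antidiagonal-inversion g a≈0 d≈0 st)
      (stabilises-𝒬⇒monomial char3 g st))
    ⊎.[ scaling-stabilises 𝒬-resp IsQ-* g , inversion-stabilises g ]

  V₀-stabiliser : (g : PGLElt F) → Stabilises F g (V₀ F) ⇔ IsScaling F g
  V₀-stabiliser g = mk⇔
    (λ st → let b≈0 , c≈0 = stabilises-V₀⇒diagonal g st in
      diagonal-scaling g b≈0 c≈0 V₀-resp (inj₁ IsQ-1) V₀⇒Q st)
    (scaling-stabilises V₀-resp V₀-* g)
    where
    V₀⇒Q : ∀ {x} → ¬ x ≈ 0# → V₀ F (just x) → IsQ F x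
    V₀⇒Q x≉0 (inj₁ x∈Q) = x∈Q
    V₀⇒Q x≉0 (inj₂ x≈0) = contradiction x≈0 x≉0

  U₀-stabiliser : (g : PGLElt F) → Stabilises F g (U₀ F) ⇔ IsScaling F g
  U₀-stabiliser g = mk⇔
    (λ st → let c≈0 , b≈0 = stabilises-U₀⇒diagonal g st in
      diagonal-scaling g b≈0 c≈0 U₀-resp IsQ-1 (λ _ x∈Q → x∈Q) st)
    (scaling-stabilises U₀-resp IsQ-* g)

  -- With q and 3 both zero in the field, so is the remainder q mod 3, whereas 1 and 2 are not.
  char3⇒3∣order : # 3 ≈ 0# → 3 ∣ suc (m ℕ.* 2)
  char3⇒3∣order 3≈0 = m%n≡0⇒n∣m q 3 (remainder≡0 (q % 3) (m%n<n q 3) #r≈0)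
    where
    q = suc (m ℕ.* 2)

    #r≈0 : # (q % 3) ≈ 0#
    #r≈0 = begin
      # (q % 3)                       ≈⟨ +-identityʳ _ ⟨
      # (q % 3) + 0#                  ≈⟨ +-congˡ (trans (*-congˡ 3≈0) (zeroʳ _)) ⟨
      # (q % 3) + # (q / 3) * # 3     ≈⟨ +-congˡ (#-homo-* (q / 3) 3) ⟨
      # (q % 3) + # (q / 3 ℕ.* 3)     ≈⟨ #-homo-+ (q % 3) (q / 3 ℕ.* 3) ⟨
      # (q % 3 ℕ.+ q / 3 ℕ.* 3)       ≡⟨ ≡.cong #_ (m≡m%n+[m/n]*n q 3) ⟨
      # q                             ≈⟨ #order≈0 ⟩
      0#                              ∎

    remainder≡0 : ∀ r → r < 3 → # r ≈ 0# → r ≡ 0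
    remainder≡0 0 _ _   = ≡.refl
    remainder≡0 1 _ 1≈0 = contradiction 1≈0 #1≉0
    remainder≡0 2 _ 2≈0 = contradiction 2≈0 #2≉0
    remainder≡0 (suc (suc (suc _))) (s<s (s<s (s<s ()))) _

-- Powers of 3 and the residue of m modulo 9.

prime-∣-^ : ∀ {p} → Prime p → ∀ {n} k → p ∣ n ^ k → p ∣ n
prime-∣-^ {p} p-prime {n} zero    p∣1   = 
  contradiction (≡.subst Prime (∣1⇒≡1 p∣1) p-prime) ¬prime[1]
prime-∣-^ {p} p-prime {n} (suc k) p∣nᵏ⁺¹ with euclidsLemma n (n ^ k) p-prime p∣nᵏ⁺¹
... | inj₁ p∣n  = p∣n
... | inj₂ p∣nᵏ = prime-∣-^ p-prime k p∣nᵏ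

3∣prime-power⇒3 : ∀ {p} k → Prime p → 3 ∣ p ^ k → p ≡ 3
3∣prime-power⇒3 k p-prime 3∣pᵏ
  with prime⇒irreducible p-prime (prime-∣-^ (from-yes (prime? 3)) k 3∣pᵏ)
... | inj₂ 3≡p = ≡.sym 3≡p

9<3^k⇒ : ∀ k → 9 < 3 ^ k → ∃ λ t → 3 ^ k ≡ t ℕ.* 9
9<3^k⇒ 0 (s<s ())
9<3^k⇒ 1 (s<s (s<s (s<s ())))
9<3^k⇒ (suc (suc k)) _ = 3 ^ k ,
  solve 1 (λ t → con 3 :* (con 3 :* t) := t :* con 9) ≡.refl (3 ^ k)
  where open +-*-Solver

-- Parity forces t = 2s + 1, and then 2m + 1 = 9t gives m = 4 + 9s.
odd-multiple-of-9 : ∀ m t → suc (m ℕ.* 2) ≡ t ℕ.* 9 → ∃ λ l → m ≡ 4 ℕ.+ l ℕ.* 9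
odd-multiple-of-9 m t eq with t % 2 | t / 2 | m≡m%n+[m/n]*n t 2 | m%n<n t 2
... | 0 | s | ≡.refl | _ = contradiction
  (≡.trans (≡.sym ([m+kn]%n≡m%n 1 m 2))
    (≡.trans (≡.cong (_% 2) (≡.trans eq
      (solve 1 (λ s → s :* con 2 :* con 9 := s :* con 9 :* con 2) ≡.refl s)))
      (m*n%n≡0 (s ℕ.* 9) 2))) λ ()
  where open +-*-Solver
... | 1 | s | ≡.refl | _ = s , ℕ.*-cancelʳ-≡ m (4 ℕ.+ s ℕ.* 9) 2 (ℕ.suc-injective (≡.trans eq
  (solve 1 (λ s → (con 1 :+ s :* con 2) :* con 9 :=
                  con 1 :+ (con 4 :+ s :* con 9) :* con 2) ≡.refl s)))
  where open +-*-Solver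
... | suc (suc _) | _ | _ | s<s (s<s ())

9<1+2m⇒4<m : ∀ m → 9 < suc (m ℕ.* 2) → 4 < m
9<1+2m⇒4<m m (s<s 9≤2m) = ℕ.≰⇒> λ m≤4 → ℕ.<⇒≱ 9≤2m (ℕ.*-monoˡ-≤ 2 m≤4)

half-order : ∀ {p m} → Prime p → ∀ k → suc (m ℕ.* 2) ≡ p ^ k → 9 < suc (m ℕ.* 2) →
             3 ∣ suc (m ℕ.* 2) → ∃ λ l → m ≡ 4 ℕ.+ l ℕ.* 9
half-order {p} {m} p-prime k q≡pᵏ 9<q 3∣q
  with 3∣prime-power⇒3 k p-prime (≡.subst (3 ∣_) q≡pᵏ 3∣q)
... | ≡.refl = odd-multiple-of-9 m t (≡.trans q≡pᵏ 3ᵏ≡9t)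
  where
  9∣3ᵏ = 9<3^k⇒ k (≡.subst (9 <_) q≡pᵏ 9<q)
  t     = proj₁ 9∣3ᵏ
  3ᵏ≡9t = proj₂ 9∣3ᵏ

theorem11 : (q : ℕ) → (∃ λ p → ∃ λ k → Prime p × 0 < k × q ≡ p ^ k) →
    q % 2 ≡ 1 → 9 < q → (F : FiniteField q) →
    ((q % 4 ≡ 1) → (g : PGLElt F) →
    Stabilises F g (𝒬 F) ⇔ (IsScaling F g ⊎ IsInversion F g)) ×
    ((g : PGLElt F) → Stabilises F g (V₀ F) ⇔ IsScaling F g) ×
    ((g : PGLElt F) → Stabilises F g (U₀ F) ⇔ IsScaling F g)
theorem11 q (p , k , p-prime , _ , q≡pᵏ) q-odd 9<q F =
  odd-case (q / 2) (≡.trans (m≡m%n+[m/n]*n q 2) (≡.cong (ℕ._+ q / 2 ℕ.* 2) q-odd)) q≡pᵏ 9<q F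
  where
  -- Generalising over q allows the equation q = 2m + 1 to be matched, which gives F the type that
  -- `Stabilisers` expects.
  odd-case : ∀ {q} m → q ≡ suc (m ℕ.* 2) → q ≡ p ^ k → 9 < q → (F : FiniteField q) →
    ((q % 4 ≡ 1) → (g : PGLElt F) → Stabilises F g (𝒬 F) ⇔ (IsScaling F g ⊎ IsInversion F g)) ×
    ((g : PGLElt F) → Stabilises F g (V₀ F) ⇔ IsScaling F g) ×
    ((g : PGLElt F) → Stabilises F g (U₀ F) ⇔ IsScaling F g)
  odd-case m ≡.refl q≡pᵏ 9<q F =
    (λ _ → 𝒬-stabiliser char3) , V₀-stabiliser , U₀-stabiliser
    where
    open Stabilisers {m} F (9<1+2m⇒4<m m 9<q)
    char3 = half-order p-prime k q≡pᵏ 9<q ∘ char3⇒3∣order
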